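{- \[ \lim_{X\to+\infty}\frac{\#\{n\le X:\ \mathcal{J}_{10}(4n+1)\equiv 0\pmod 2\}}{X}=1, \] where $n$ ranges over positive integers.
   Context: Let $q=e^{2\pi i\tau}$ with $\tau$ in the upper half-plane, and let $\eta(\tau)=q^{1/24}\prod_{n\ge1}(1-q^n)$ be the Dedekind eta function. The Hauptmodul of $\Gamma_0(10)$ is \[ j_{10}(\tau)=\frac{\eta(2\tau)\eta(5\tau)^5}{\eta(\tau)\eta(10\tau)^5}-1=\frac1q+\sum_{n\ge1}\mathcal{J}_{10}(n)q^n, \] and $\mathcal{J}_{10}(n)$ denotes its $n$-th Fourier coefficient (an integer). -}

module Defs where

open import Data.Nat as ℕ using (ℕ; zero; suc)
open import Data.Nat.Divisibility as ℕD using (_∣?_)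
open import Data.Integer as ℤ using (ℤ; +_; -_; ∣_∣)
open import Data.Integer.Divisibility as ℤD using ()
open import Data.List using (List; []; _∷_; upTo; map; filter; length)
open import Data.Bool using (if_then_else_)
open import Relation.Nullary using (Dec; yes; no; does)

Series : Set
Series = ℕ → ℤ

sumTo : ℕ → (ℕ → ℤ) → ℤ
sumTo zero    f = f 0
sumTo (suc n) f = sumTo n f ℤ.+ f (suc n)

_⊛_ : Series → Series → Series
(f ⊛ g) n = sumTo n (λ i → f i ℤ.* g (n ℕ.∸ i))

one : Series
one zero    = + 1
one (suc _) = + 0

-- (1 - q^d), for d ≥ 1
oneMinus : ℕ → Series
oneMinus d n = if does (n ℕ.≟ 0) then + 1 else (if does (n ℕ.≟ d) then - (+ 1) else + 0)

-- 1/(1 - q^d) = Σ_k q^{dk}, for d ≥ 1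
geom : ℕ → Series
geom d n = if does (d ∣? n) then + 1 else + 0

pow : Series → ℕ → Series
pow s zero    = one
pow s (suc k) = s ⊛ pow s k

factor : ℕ → Series
factor n = oneMinus (2 ℕ.* n) ⊛ (pow (oneMinus (5 ℕ.* n)) 5 ⊛ (geom n ⊛ pow (geom (10 ℕ.* n)) 5))

partialProd : ℕ → Series
partialProd zero    = one
partialProd (suc N) = factor (suc N) ⊛ partialProd N

-- F(q) = ∏_{n≥1} factor n ; its m-th coefficient equals that of the partial
-- product up to N for any N ≥ m (factor n ≡ 1 mod q^n).
Fcoeff : ℕ → ℤ
Fcoeff m = partialProd m m

-- j₁₀(τ) = q^{-1} F(q) - 1 = 1/q + Σ_{n≥1} J₁₀(n) q^n, so for n ≥ 1
-- J₁₀(n) = coefficient of q^{n+1} in F.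
J10 : ℕ → ℤ
J10 n = Fcoeff (suc n)

evenCount : ℕ → ℕ
evenCount X = length (filter (λ n → 2 ∣? ∣ J10 (4 ℕ.* n ℕ.+ 1) ∣) (map suc (upTo X)))

{-# OPTIONS --safe #-}
module Submission where

-- Write f_d = ∏ (1 - q^dn). Modulo 2 Frobenius gives F = f₁ / f₅⁵, that is F f₅⁶ = f₁ f₅ =: U.
-- Dissecting a series t² g over 𝔽₂ into even and odd exponents only dissects g, so two facts
-- about theta series suffice: f_d³ = ∑ q^{d j(j+1)/2} (Gauss) and
-- U = ∑ q^{j(j+1)} + q ∑ q^{5 r(r+1)}. The even part of U is f₁³ and its odd part is f₅³; the even
-- part of F is then f₁³ / f₅³, and the odd part of that is f₁ f₅ = U again. So the coefficient of
-- q^{4n+2} in F has the parity of the coefficient of q^n in U, which is odd for O(√X) indices n ≤ X.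
--
-- Both theta identities come from f_d = ∑_{v ∈ ℤ} q^{d v(3v-1)/2}: for a = 1, 2 and c = 3a - 1,
-- f_d f_{cd} = ∑_{j ≥ 0} ∑_{v ∈ ℤ} q^{d h(j,v)} with h(j,v) = a j(j+1)/2 - jv + v(3v-1)/2, because
-- the rows j ≡ 1 mod 3 cancel under v ↦ 1 - v. In the columns h(j,-v) = h(j + 2v/a, v), so v and -v
-- leave only 0 ≤ j < 2v/a, where j ↦ 2v/a - 1 - j cancels everything but a possible midpoint.

open import Defs
open import Algebra.Bundles using (CommutativeSemiring)
open import Data.Bool using (true; false; if_then_else_)
open import Data.Empty using (⊥-elim)
open import Data.Integer.Base as ℤ using (ℤ; +_; -[1+_]; +[1+_]; ∣_∣)
import Data.Integer.Properties as ℤ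
open import Data.Integer.Tactic.RingSolver using () renaming (solve-∀ to solve-ℤ)
open import Data.List using ([]; _∷_; _++_; upTo; map; filter; length; [_])
open import Data.List.Properties using (map-++; filter-++; length-++; upTo-∷ʳ; filter-accept)
open import Data.Maybe.Base as Maybe using (Maybe; just; nothing)
open import Data.Nat using (ℕ; _*_; _∸_; _≤_; NonZero)
open import Data.Nat.Base as ℕ using (zero; suc; z≤n; s≤s; parity)
open import Data.Nat.Divisibility as ℕD using (_∣_; _∣?_)
import Data.Nat.Properties as ℕ
open import Data.Nat.Tactic.RingSolver using () renaming (solve-∀ to solve-ℕ)
open import Data.Parity.Base as ℙ using (Parity; 0ℙ; 1ℙ)
import Data.Parity.Properties as ℙ
open import Algebra.Properties.CommutativeSemigroup ℙ.+-commutativeSemigroup using (interchange)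
open import Data.Product using (_,_; ∃-syntax; _×_)
open import Data.Sum using (_⊎_; inj₁; inj₂)
open import Function using (_∘_)
open import Function.Bundles using (mk⇔)
open import Level using (0ℓ)
open import Relation.Binary.PropositionalEquality
  using (_≡_; refl; sym; trans; cong; cong₂; subst; module ≡-Reasoning)
open import Relation.Binary.Structures using (IsEquivalence)
open import Relation.Nullary using (¬_; yes; no; does)
open import Relation.Nullary.Decidable using (does-⇔; dec-true; dec-false)
open import Relation.Unary using (Decidable)

-- Power series over 𝔽₂

-- The form h comes from diagonalising: 6 h(j,v) = u(u - 1) + c j(j + 1) with u = 3v - j. Restricted
-- to one residue class of j modulo 3, the two summands separate into pentagonal exponents, so rows
-- and columns read the same double sum in two ways. The columns need 2v/a to be an integer for
-- every v; this leaves a = 1, 2, hence only the pairs f_d f_{2d} and f_d f_{5d}. Modulo 2 the signs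
-- of the pentagonal series disappear, and every pairing of equal exponents cancels.
--
-- F is given through partial products, so no infinite product is formed: congruences hold up to a
-- degree m, sums run over finite windows, and each reindexing must be exact there. Much of the work
-- is to show that terms beyond the edge of a window vanish. Inverses are avoided as well: the
-- relations are multiplied by powers of f₅, and f₅² is cancelled at the end because its constant
-- coefficient is 1.

Series₂ : Set
Series₂ = ℕ → Parity

tail : Series₂ → Series₂
tail f n = f (suc n)

infixl 6 _⊕_
infixl 7 _⊗_

_⊕_ : Series₂ → Series₂ → Series₂
(f ⊕ g) n = f n ℙ.+ g n

-- The Cauchy product by recursion through f = f 0 + q · tail f. It peels only the left factor;
-- `⊗-sucʳ` supplies the right one, and with it commutativity.
_⊗_ : Series₂ → Series₂ → Series₂
(f ⊗ g) zero    = f 0 ℙ.* g 0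
(f ⊗ g) (suc n) = f 0 ℙ.* g (suc n) ℙ.+ (tail f ⊗ g) n

0ₛ : Series₂
0ₛ _ = 0ℙ

1ₛ : Series₂
1ₛ zero    = 1ℙ
1ₛ (suc _) = 0ℙ

scale : Parity → Series₂ → Series₂
scale c f n = c ℙ.* f n

⊗-sucʳ : ∀ f g n → (f ⊗ g) (suc n) ≡ f (suc n) ℙ.* g 0 ℙ.+ (f ⊗ tail g) n
⊗-sucʳ f g zero    = ℙ.+-comm (f 0 ℙ.* g 1) (f 1 ℙ.* g 0)
⊗-sucʳ f g (suc n) rewrite ⊗-sucʳ (tail f) g n
  = trans (sym (ℙ.+-assoc a b c)) (trans (cong (ℙ._+ c) (ℙ.+-comm a b)) (ℙ.+-assoc b a c))
  where
  a = f 0 ℙ.* g (2 ℕ.+ n)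
  b = f (2 ℕ.+ n) ℙ.* g 0
  c = (tail f ⊗ tail g) n

⊗-comm : ∀ f g n → (f ⊗ g) n ≡ (g ⊗ f) n
⊗-comm f g zero    = ℙ.*-comm (f 0) (g 0)
⊗-comm f g (suc n) = trans (cong₂ ℙ._+_ (ℙ.*-comm (f 0) (g (suc n))) (⊗-comm (tail f) g n))
                           (sym (⊗-sucʳ g f n))

⊗-distribʳ : ∀ h f g n → ((f ⊕ g) ⊗ h) n ≡ (f ⊗ h) n ℙ.+ (g ⊗ h) n
⊗-distribʳ h f g zero    = ℙ.*-distribʳ-+ (h 0) (f 0) (g 0)
⊗-distribʳ h f g (suc n)
  rewrite ℙ.*-distribʳ-+ (h (suc n)) (f 0) (g 0) | ⊗-distribʳ h (tail f) (tail g) n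
  = interchange (f 0 ℙ.* h (suc n)) (g 0 ℙ.* h (suc n)) _ _

⊗-scale : ∀ c f g n → (scale c f ⊗ g) n ≡ c ℙ.* (f ⊗ g) n
⊗-scale c f g zero    = ℙ.*-assoc c (f 0) (g 0)
⊗-scale c f g (suc n) rewrite ⊗-scale c (tail f) g n | ℙ.*-assoc c (f 0) (g (suc n))
  = sym (ℙ.*-distribˡ-+ c _ _)

⊗-assoc : ∀ f g h n → ((f ⊗ g) ⊗ h) n ≡ (f ⊗ (g ⊗ h)) n
⊗-assoc f g h zero    = ℙ.*-assoc (f 0) (g 0) (h 0)
⊗-assoc f g h (suc n)
  rewrite ⊗-distribʳ h (scale (f 0) (tail g)) (tail f ⊗ g) n
        | ⊗-scale (f 0) (tail g) h n
        | ⊗-assoc (tail f) g h n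
        | ℙ.*-assoc (f 0) (g 0) (h (suc n))
        | ℙ.*-distribˡ-+ (f 0) (g 0 ℙ.* h (suc n)) ((tail g ⊗ h) n)
  = sym (ℙ.+-assoc (f 0 ℙ.* (g 0 ℙ.* h (suc n))) _ _)

⊗-zeroˡ : ∀ f n → (0ₛ ⊗ f) n ≡ 0ℙ
⊗-zeroˡ f zero    = refl
⊗-zeroˡ f (suc n) = ⊗-zeroˡ f n

⊗-identityˡ : ∀ f n → (1ₛ ⊗ f) n ≡ f n
⊗-identityˡ f zero    = refl
⊗-identityˡ f (suc n) = trans (cong (f (suc n) ℙ.+_) (⊗-zeroˡ f n)) (ℙ.+-identityʳ _)

-- Congruence up to degree m

infix 4 _≈[_]_

_≈[_]_ : Series₂ → ℕ → Series₂ → Set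
f ≈[ m ] g = ∀ n → n ℕ.≤ m → f n ≡ g n

⊗-cong : ∀ {m f f′ g g′} → f ≈[ m ] f′ → g ≈[ m ] g′ → f ⊗ g ≈[ m ] f′ ⊗ g′
⊗-cong p q zero    _ = cong₂ ℙ._*_ (p 0 z≤n) (q 0 z≤n)
⊗-cong {suc m} p q (suc n) (s≤s l) = cong₂ ℙ._+_ (cong₂ ℙ._*_ (p 0 z≤n) (q (suc n) (s≤s l)))
  (⊗-cong {m} (λ k k≤ → p (suc k) (s≤s k≤)) (λ k k≤ → q k (ℕ.m≤n⇒m≤1+n k≤)) n l)

semiring : ℕ → CommutativeSemiring 0ℓ 0ℓ
semiring m = record
  { Carrier = Series₂ ; _≈_ = _≈[ m ]_ ; _+_ = _⊕_ ; _*_ = _⊗_ ; 0# = 0ₛ ; 1# = 1ₛ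
  ; isCommutativeSemiring = record
    { isSemiring = record
      { isSemiringWithoutAnnihilatingZero = record
        { +-isCommutativeMonoid = record
          { isMonoid = record
            { isSemigroup = record
              { isMagma = record
                { isEquivalence = equiv
                ; ∙-cong = λ p q n l → cong₂ ℙ._+_ (p n l) (q n l) }
              ; assoc = λ f g h n _ → ℙ.+-assoc (f n) (g n) (h n) }
            ; identity = (λ f n _ → refl) , (λ f n _ → ℙ.+-identityʳ (f n)) }
          ; comm = λ f g n _ → ℙ.+-comm (f n) (g n) }
        ; *-cong = ⊗-cong
        ; *-assoc = λ f g h n _ → ⊗-assoc f g h n
        ; *-identity = (λ f n _ → ⊗-identityˡ f n)
                     , (λ f n _ → trans (⊗-comm f 1ₛ n) (⊗-identityˡ f n))
        ; distrib = (λ h f g n _ → trans (⊗-comm h (f ⊕ g) n)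
                      (trans (⊗-distribʳ h f g n) (cong₂ ℙ._+_ (⊗-comm f h n) (⊗-comm g h n))))
                  , (λ h f g n _ → ⊗-distribʳ h f g n) }
      ; zero = (λ f n _ → ⊗-zeroˡ f n) , (λ f n _ → trans (⊗-comm f 0ₛ n) (⊗-zeroˡ f n)) }
    ; *-comm = λ f g n _ → ⊗-comm f g n } }
  where
  equiv : IsEquivalence _≈[ m ]_
  equiv = record { refl = λ _ _ → refl ; sym = λ p n l → sym (p n l)
                 ; trans = λ p q n l → trans (p n l) (q n l) }

-- As f 0 = 1, coefficient n + 1 of f ⊗ g is g (n + 1) plus terms in lower coefficients of g. The
-- bound `b` in `go` makes the induction strong: all lower coefficients have to agree at once.
⊗-cancelˡ : ∀ {m} f {g h} → f 0 ≡ 1ℙ → f ⊗ g ≈[ m ] f ⊗ h → g ≈[ m ] h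
⊗-cancelˡ {m} f {g} {h} f₀ p n l = go n l n ℕ.≤-refl
  where
  go : ∀ b → b ℕ.≤ m → g ≈[ b ] h
  go b b≤m zero _ = subst (λ c → c ℙ.* g 0 ≡ c ℙ.* h 0) f₀ (p 0 z≤n)
  go (suc b) b≤m (suc n) (s≤s n≤b) = ℙ.+-cancelʳ-≡ ((tail f ⊗ h) n) (g (suc n)) (h (suc n))
    (trans (cong (g (suc n) ℙ.+_) (sym tails))
      (subst (λ c → c ℙ.* g (suc n) ℙ.+ (tail f ⊗ g) n ≡ c ℙ.* h (suc n) ℙ.+ (tail f ⊗ h) n) f₀
        (p (suc n) (ℕ.≤-trans (s≤s n≤b) b≤m))))
    where
    tails : (tail f ⊗ g) n ≡ (tail f ⊗ h) n
    tails = ⊗-cong (λ _ _ → refl) (go b (ℕ.<⇒≤ b≤m)) n n≤b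

mono : ℕ → Series₂
mono zero    = 1ₛ
mono (suc d) zero    = 0ℙ
mono (suc d) (suc n) = mono d n

mono-⊗-+ : ∀ d f n → (mono d ⊗ f) (d ℕ.+ n) ≡ f n
mono-⊗-+ zero    f n = ⊗-identityˡ f n
mono-⊗-+ (suc d) f n = mono-⊗-+ d f n

mono-⊗-< : ∀ d f n → n ℕ.< d → (mono d ⊗ f) n ≡ 0ℙ
mono-⊗-< (suc d) f zero    _       = refl
mono-⊗-< (suc d) f (suc n) (s≤s l) = mono-⊗-< d f n l

mono-+ : ∀ d e n → (mono d ⊗ mono e) n ≡ mono (d ℕ.+ e) n
mono-+ zero    e n       = ⊗-identityˡ (mono e) n
mono-+ (suc d) e zero    = refl
mono-+ (suc d) e (suc n) = mono-+ d e n

mono≈0 : ∀ {m d} → m ℕ.< d → mono d ≈[ m ] 0ₛ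
mono≈0 {d = suc d} _ zero _ = refl
mono≈0 {suc m} {suc d} (s≤s l) (suc n) (s≤s k) = mono≈0 l n k

⊗-head-tail : ∀ f g n → (f ⊗ g) n ≡ f 0 ℙ.* g n ℙ.+ (mono 1 ⊗ (tail f ⊗ g)) n
⊗-head-tail f g zero    = sym (ℙ.+-identityʳ _)
⊗-head-tail f g (suc n) = cong (f 0 ℙ.* g (suc n) ℙ.+_) (sym (⊗-identityˡ (tail f ⊗ g) n))

-- Even and odd dissection

double : ℕ → ℕ
double zero    = zero
double (suc n) = suc (suc (double n))

even odd : Series₂ → Series₂
even f n = f (double n)
odd f n = f (suc (double n))

-- Proved together with `odd-⊗`, because peeling one coefficient of `f` swaps the parities. The
-- `mono 1` is the q² that two odd exponents contribute, with its exponent halved.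
even-⊗ : ∀ f g n → even (f ⊗ g) n ≡ (even f ⊗ even g) n ℙ.+ (mono 1 ⊗ (odd f ⊗ odd g)) n
odd-⊗ : ∀ f g n → odd (f ⊗ g) n ≡ (even f ⊗ odd g) n ℙ.+ (odd f ⊗ even g) n

even-⊗ f g zero    = sym (ℙ.+-identityʳ _)
even-⊗ f g (suc n) = begin
  a ℙ.+ odd (tail f ⊗ g) n ≡⟨ cong (a ℙ.+_) (odd-⊗ (tail f) g n) ⟩
  a ℙ.+ (x ℙ.+ y)          ≡⟨ cong (a ℙ.+_) (ℙ.+-comm x y) ⟩
  a ℙ.+ (y ℙ.+ x)          ≡⟨ ℙ.+-assoc a y x ⟨
  a ℙ.+ y ℙ.+ x            ≡⟨ cong (a ℙ.+ y ℙ.+_) (⊗-identityˡ (odd f ⊗ odd g) n) ⟨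
  a ℙ.+ y ℙ.+ (1ₛ ⊗ (odd f ⊗ odd g)) n ∎
  where
  open ≡-Reasoning
  a = f 0 ℙ.* g (double (suc n))
  x = (odd f ⊗ odd g) n
  y = (tail (even f) ⊗ even g) n
odd-⊗ f g n = begin
  a ℙ.+ even (tail f ⊗ g) n ≡⟨ cong (a ℙ.+_) (even-⊗ (tail f) g n) ⟩
  a ℙ.+ ((odd f ⊗ even g) n ℙ.+ (mono 1 ⊗ (tail (even f) ⊗ odd g)) n) 
    ≡⟨ trans (cong (a ℙ.+_) (ℙ.+-comm x y)) (sym (ℙ.+-assoc a y x)) ⟩
  a ℙ.+ y ℙ.+ x ≡⟨ cong (ℙ._+ x) (⊗-head-tail (even f) (odd g) n) ⟨
  (even f ⊗ odd g) n ℙ.+ (odd f ⊗ even g) n ∎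
  where
  open ≡-Reasoning
  a = f 0 ℙ.* odd g n
  x = (odd f ⊗ even g) n
  y = (mono 1 ⊗ (tail (even f) ⊗ odd g)) n

-- With f = f 0 + q t the cross term f 0 · q t occurs twice in the square and cancels, leaving (f
-- 0)² + q² t².
square-suc² : ∀ f n → (f ⊗ f) (2 ℕ.+ n) ≡ (tail f ⊗ tail f) n
square-suc² f n = begin
  a ℙ.+ (tail f ⊗ f) (suc n)                       ≡⟨ cong (a ℙ.+_) (⊗-sucʳ (tail f) f n) ⟩
  a ℙ.+ (f (2 ℕ.+ n) ℙ.* f 0 ℙ.+ (tail f ⊗ tail f) n) ≡⟨ cong (λ b → a ℙ.+ (b ℙ.+ (tail f ⊗ tail f) n)) (ℙ.*-comm (f (2 ℕ.+ n)) (f 0)) ⟩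
  a ℙ.+ (a ℙ.+ (tail f ⊗ tail f) n)                ≡⟨ ℙ.+-assoc a a _ ⟨
  a ℙ.+ a ℙ.+ (tail f ⊗ tail f) n                  ≡⟨ cong (ℙ._+ (tail f ⊗ tail f) n) (ℙ.p+p≡0ℙ a) ⟩
  (tail f ⊗ tail f) n                              ∎
  where
  open ≡-Reasoning
  a = f 0 ℙ.* f (2 ℕ.+ n)

even-square : ∀ f n → even (f ⊗ f) n ≡ f n
even-square f zero    = ℙ.*-idem (f 0)
even-square f (suc n) = trans (square-suc² f (double n)) (even-square (tail f) n)

odd-square : ∀ f n → odd (f ⊗ f) n ≡ 0ℙ
odd-square f zero    = trans (cong (ℙ._+ (f 1 ℙ.* f 0)) (ℙ.*-comm (f 0) (f 1))) (ℙ.p+p≡0ℙ (f 1 ℙ.* f 0))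
odd-square f (suc n) = trans (square-suc² f (suc (double n))) (odd-square (tail f) n)

even-square-⊗ : ∀ f g n → even ((f ⊗ f) ⊗ g) n ≡ (f ⊗ even g) n
even-square-⊗ f g n = begin
  even ((f ⊗ f) ⊗ g) n ≡⟨ even-⊗ (f ⊗ f) g n ⟩
  (even (f ⊗ f) ⊗ even g) n ℙ.+ (mono 1 ⊗ (odd (f ⊗ f) ⊗ odd g)) n
    ≡⟨ cong₂ ℙ._+_ (⊗-cong {n} (λ k _ → even-square f k) (λ _ _ → refl) n ℕ.≤-refl)
                   (⊗-cong {n} {mono 1} (λ _ _ → refl) (λ k _ → trans (⊗-cong {k} (λ i _ → odd-square f i) (λ _ _ → refl) k ℕ.≤-refl) (⊗-zeroˡ (odd g) k)) n ℕ.≤-refl) ⟩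
  (f ⊗ even g) n ℙ.+ (mono 1 ⊗ 0ₛ) n ≡⟨ cong ((f ⊗ even g) n ℙ.+_) (trans (⊗-comm (mono 1) 0ₛ n) (⊗-zeroˡ (mono 1) n)) ⟩
  (f ⊗ even g) n ℙ.+ 0ℙ ≡⟨ ℙ.+-identityʳ _ ⟩
  (f ⊗ even g) n ∎
  where open ≡-Reasoning

odd-square-⊗ : ∀ f g n → odd ((f ⊗ f) ⊗ g) n ≡ (f ⊗ odd g) n
odd-square-⊗ f g n = begin
  odd ((f ⊗ f) ⊗ g) n ≡⟨ odd-⊗ (f ⊗ f) g n ⟩
  (even (f ⊗ f) ⊗ odd g) n ℙ.+ (odd (f ⊗ f) ⊗ even g) n
    ≡⟨ cong₂ ℙ._+_ (⊗-cong {n} (λ k _ → even-square f k) (λ _ _ → refl) n ℕ.≤-refl)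
                   (trans (⊗-cong {n} (λ k _ → odd-square f k) (λ _ _ → refl) n ℕ.≤-refl) (⊗-zeroˡ (even g) n)) ⟩
  (f ⊗ odd g) n ℙ.+ 0ℙ ≡⟨ ℙ.+-identityʳ _ ⟩
  (f ⊗ odd g) n ∎
  where open ≡-Reasoning

-- The pentagonal number theorem modulo 2

∑ : ℕ → (ℕ → Parity) → Parity
∑ zero    f = 0ℙ
∑ (suc k) f = ∑ k f ℙ.+ f k

∑-cong : ∀ K {f g} → (∀ i → i ℕ.< K → f i ≡ g i) → ∑ K f ≡ ∑ K g
∑-cong zero    p = refl
∑-cong (suc K) p = cong₂ ℙ._+_ (∑-cong K (λ i l → p i (ℕ.m≤n⇒m≤1+n l))) (p K ℕ.≤-refl)

∑-zero : ∀ K {f} → (∀ i → i ℕ.< K → f i ≡ 0ℙ) → ∑ K f ≡ 0ℙ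
∑-zero zero    p = refl
∑-zero (suc K) p = cong₂ ℙ._+_ (∑-zero K (λ i l → p i (ℕ.m≤n⇒m≤1+n l))) (p K ℕ.≤-refl)

∑ₛ : ℕ → (ℕ → Series₂) → Series₂
∑ₛ K F n = ∑ K (λ i → F i n)

tri : ℕ → ℕ
tri zero    = zero
tri (suc n) = tri n ℕ.+ suc n

-- The generalised pentagonal numbers v(3v-1)/2 at v = -i and v = i + 1.
pent⁻ pent⁺ : ℕ → ℕ
pent⁻ i = i ℕ.* i ℕ.+ tri i
pent⁺ i = suc i ℕ.* suc i ℕ.+ tri i

pentagonal : ℕ → ℕ → Series₂
pentagonal d K = ∑ₛ K (λ i → mono (d ℕ.* pent⁻ i) ⊕ mono (d ℕ.* pent⁺ i))

product : ℕ → ℕ → Series₂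
product d zero    = 1ₛ
product d (suc n) = (1ₛ ⊕ mono (d ℕ.* suc n)) ⊗ product d n

module Modulo (m : ℕ) where

  open CommutativeSemiring (semiring m) public
    using (_≈_; setoid; *-comm; *-identityˡ; *-identityʳ; zeroʳ; +-identityʳ)
    renaming ( refl to ≈-refl; sym to ≈-sym; trans to ≈-trans; +-cong to ⊕-cong; +-congˡ to ⊕-congˡ
             ; +-congʳ to ⊕-congʳ; *-congˡ to ⊗-congˡ; *-congʳ to ⊗-congʳ)
  open import Algebra.Properties.Semiring.Mult (CommutativeSemiring.semiring (semiring m)) using () renaming (_×_ to _×ₘ_)

  2+×1 : ∀ i → suc (suc i) ×ₘ 1ₛ ≈ i ×ₘ 1ₛ
  2+×1 i n l = trans (sym (ℙ.+-assoc (1ₛ n) (1ₛ n) _)) (cong (ℙ._+ (i ×ₘ 1ₛ) n) (ℙ.p+p≡0ℙ (1ₛ n)))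

  -- Lets the ring solver compare numerical coefficients modulo 2, so that it discards doubled terms
  -- by itself.
  coefficient-≟ : ∀ i j → Maybe (i ×ₘ 1ₛ ≈ j ×ₘ 1ₛ)
  coefficient-≟ zero          zero          = just ≈-refl
  coefficient-≟ (suc zero)    (suc zero)    = just ≈-refl
  coefficient-≟ zero          (suc zero)    = nothing
  coefficient-≟ (suc zero)    zero          = nothing
  coefficient-≟ (suc (suc i)) j             = Maybe.map (≈-trans (2+×1 i)) (coefficient-≟ i j)
  coefficient-≟ i             (suc (suc j)) = Maybe.map (λ p → ≈-trans p (≈-sym (2+×1 j))) (coefficient-≟ i j)

  open import Algebra.Solver.Ring.NaturalCoefficients (semiring m) coefficient-≟ public

-- Shanks' finite form of the pentagonal number theorem

module _ (d : ℕ) where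

  X : ℕ → Series₂
  X e = mono (d ℕ.* e)

  -- The product of 1 + q^{de} over s < e ≤ s + i: the quotient of two partial products in Shanks'
  -- identity, formed without division.
  between : ℕ → ℕ → Series₂
  between zero    s = 1ₛ
  between (suc i) s = (1ₛ ⊕ X (suc s)) ⊗ between i (suc s)

  module _ (m : ℕ) where
    open Modulo m
    open import Relation.Binary.Reasoning.Setoid setoid

    X-+ : ∀ e e′ → X e ⊗ X e′ ≈ X (e ℕ.+ e′)
    X-+ e e′ n _ = trans (mono-+ (d ℕ.* e) (d ℕ.* e′) n) (cong (λ k → mono k n) (sym (ℕ.*-distribˡ-+ d e e′)))

    X≡ : ∀ {e e′} → e ≡ e′ → X e ≈ X e′
    X≡ refl = ≈-refl

    X0≈1 : X 0 ≈ 1ₛ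
    X0≈1 n _ = cong (λ k → mono k n) (ℕ.*-zeroʳ d)

    between-last : ∀ i s → between (suc i) s ≈ (1ₛ ⊕ X (s ℕ.+ suc i)) ⊗ between i s
    between-last zero    s = ⊗-congʳ {1ₛ} (⊕-congˡ {1ₛ} (X≡ (sym (ℕ.+-comm s 1))))
    between-last (suc i) s = begin
      (1ₛ ⊕ X (suc s)) ⊗ between (suc i) (suc s) ≈⟨ ⊗-congˡ {1ₛ ⊕ X (suc s)} (between-last i (suc s)) ⟩
      (1ₛ ⊕ X (suc s)) ⊗ ((1ₛ ⊕ X (suc s ℕ.+ suc i)) ⊗ between i (suc s))
        ≈⟨ solve 3 (λ a b c → a :* (b :* c) := b :* (a :* c)) ≈-refl (1ₛ ⊕ X (suc s)) (1ₛ ⊕ X (suc s ℕ.+ suc i)) (between i (suc s)) ⟩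
      (1ₛ ⊕ X (suc s ℕ.+ suc i)) ⊗ between (suc i) s
        ≈⟨ ⊗-congʳ {between (suc i) s} (⊕-congˡ {1ₛ} (X≡ (sym (ℕ.+-suc s (suc i))))) ⟩
      (1ₛ ⊕ X (s ℕ.+ suc (suc i))) ⊗ between (suc i) s ∎

    product≈between : ∀ n → product d n ≈ between n 0
    product≈between zero    = ≈-refl
    product≈between (suc n) = ≈-trans (⊗-congˡ {1ₛ ⊕ X (suc n)} (product≈between n)) (≈-sym (between-last n 0))

    -- Shanks: the sum of term n n s over s < n is pentagonal d n, while its summand s = 0 is the
    -- whole product and all others are O(q^{dn}).
    term : ℕ → ℕ → ℕ → Series₂
    term n k s = between (n ℕ.∸ s) s ⊗ X (s ℕ.* k ℕ.+ tri s)

    -- What the sum of the first t terms gains when n grows to n + 1. At t = n + 1 it has become the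
    -- single monomial with exponent `pent⁺ n`.
    carry : ℕ → ℕ → Series₂
    carry n zero    = 0ₛ
    carry n (suc t) = between (n ℕ.∸ t) t ⊗ X (suc t ℕ.* suc n ℕ.+ tri t)

    carry-closed : ∀ n t → t ℕ.≤ n → carry n t ≈ (1ₛ ⊕ X t) ⊗ term n n t
    carry-closed n zero    _ = ≈-sym (begin
      (1ₛ ⊕ X 0) ⊗ term n n 0 ≈⟨ ⊗-congʳ {term n n 0} (⊕-congˡ {1ₛ} X0≈1) ⟩
      (1ₛ ⊕ 1ₛ) ⊗ term n n 0  ≈⟨ solve 1 (λ a → (con 1 :+ con 1) :* a := con 0) ≈-refl (term n n 0) ⟩
      0ₛ ∎)
    carry-closed n (suc t) t<n = begin
      between (n ℕ.∸ t) t ⊗ X (suc t ℕ.* suc n ℕ.+ tri t)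
        ≈⟨ (λ k _ → cong (λ i → (between i t ⊗ X (suc t ℕ.* suc n ℕ.+ tri t)) k) (ℕ.+-∸-assoc 1 t<n)) ⟩
      (1ₛ ⊕ X (suc t)) ⊗ between (n ℕ.∸ suc t) (suc t) ⊗ X (suc t ℕ.* suc n ℕ.+ tri t)
        ≈⟨ solve 3 (λ a b c → a :* b :* c := a :* (b :* c)) ≈-refl (1ₛ ⊕ X (suc t)) (between (n ℕ.∸ suc t) (suc t)) (X (suc t ℕ.* suc n ℕ.+ tri t)) ⟩
      (1ₛ ⊕ X (suc t)) ⊗ (between (n ℕ.∸ suc t) (suc t) ⊗ X (suc t ℕ.* suc n ℕ.+ tri t))
        ≈⟨ ⊗-congˡ {1ₛ ⊕ X (suc t)} (⊗-congˡ {between (n ℕ.∸ suc t) (suc t)} (X≡ (exponents t n (tri t)))) ⟩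
      (1ₛ ⊕ X (suc t)) ⊗ term n n (suc t) ∎
      where
      exponents : ∀ t n T → suc t ℕ.* suc n ℕ.+ T ≡ suc t ℕ.* n ℕ.+ (T ℕ.+ suc t)
      exponents = solve-ℕ

    telescope : ∀ n t → t ℕ.≤ suc n → ∑ₛ t (term (suc n) (suc n)) ≈ ∑ₛ t (term n n) ⊕ carry n t
    telescope n zero    _ = ≈-refl
    telescope n (suc t) (s≤s t≤n) = begin
      ∑ₛ t (term (suc n) (suc n)) ⊕ term (suc n) (suc n) t
        ≈⟨ ⊕-cong (telescope n t (ℕ.m≤n⇒m≤1+n t≤n)) new ⟩
      (S ⊕ carry n t) ⊕ ((1ₛ ⊕ z) ⊗ b) ⊗ (x ⊗ y)
        ≈⟨ ⊕-congʳ {((1ₛ ⊕ z) ⊗ b) ⊗ (x ⊗ y)} (⊕-congˡ {S} (carry-closed n t t≤n)) ⟩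
      (S ⊕ (1ₛ ⊕ x) ⊗ (b ⊗ y)) ⊕ ((1ₛ ⊕ z) ⊗ b) ⊗ (x ⊗ y)
        -- The two copies of b x y cancel in characteristic 2; b y is the old summand t and b z x y
        -- the next carry.
        ≈⟨ solve 5 (λ S z b x y → (S :+ (con 1 :+ x) :* (b :* y)) :+ ((con 1 :+ z) :* b) :* (x :* y)
                                    := (S :+ b :* y) :+ b :* (z :* (x :* y))) ≈-refl S z b x y ⟩
      (S ⊕ b ⊗ y) ⊕ b ⊗ (z ⊗ (x ⊗ y))
        ≈⟨ ⊕-congˡ {S ⊕ b ⊗ y} (⊗-congˡ {b} last) ⟩
      (S ⊕ b ⊗ y) ⊕ carry n (suc t) ∎
      where
      S = ∑ₛ t (term n n)
      b = between (n ℕ.∸ t) t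
      x = X t
      y = X (t ℕ.* n ℕ.+ tri t)
      z = X (suc n)
      exponent₁ : ∀ t n T → t ℕ.+ (t ℕ.* n ℕ.+ T) ≡ t ℕ.* suc n ℕ.+ T
      exponent₁ = solve-ℕ
      exponent₂ : ∀ t n T → suc n ℕ.+ (t ℕ.+ (t ℕ.* n ℕ.+ T)) ≡ suc t ℕ.* suc n ℕ.+ T
      exponent₂ = solve-ℕ
      last : z ⊗ (x ⊗ y) ≈ X (suc t ℕ.* suc n ℕ.+ tri t)
      last = ≈-trans (⊗-congˡ {z} (X-+ t _)) (≈-trans (X-+ (suc n) _) (X≡ (exponent₂ t n (tri t))))
      new : term (suc n) (suc n) t ≈ ((1ₛ ⊕ z) ⊗ b) ⊗ (x ⊗ y)
      new = begin
        between (suc n ℕ.∸ t) t ⊗ X (t ℕ.* suc n ℕ.+ tri t)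
          ≈⟨ (λ k _ → cong (λ i → (between i t ⊗ X (t ℕ.* suc n ℕ.+ tri t)) k) (ℕ.+-∸-assoc 1 t≤n)) ⟩
        between (suc (n ℕ.∸ t)) t ⊗ X (t ℕ.* suc n ℕ.+ tri t)
          ≈⟨ ⊗-cong (between-last (n ℕ.∸ t) t) (≈-sym (≈-trans (X-+ t _) (X≡ (exponent₁ t n (tri t))))) ⟩
        ((1ₛ ⊕ X (t ℕ.+ suc (n ℕ.∸ t))) ⊗ b) ⊗ (x ⊗ y)
          ≈⟨ ⊗-congʳ {x ⊗ y} (⊗-congʳ {b} (⊕-congˡ {1ₛ} (X≡ (trans (ℕ.+-suc t _) (cong suc (ℕ.m+[n∸m]≡n t≤n)))))) ⟩
        ((1ₛ ⊕ z) ⊗ b) ⊗ (x ⊗ y) ∎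

    carry-end : ∀ n → carry n (suc n) ≈ X (pent⁺ n)
    carry-end n = ≈-trans (λ k _ → cong (λ i → (between i n ⊗ X (pent⁺ n)) k) (ℕ.n∸n≡0 n)) (*-identityˡ (X (pent⁺ n)))

    -- The two pentagonal families enter alternately: the top summand s = n contributes `pent⁻ n`,
    -- since its `between` is empty, and the step from n to n + 1 contributes `pent⁺ n` as the final
    -- carry.
    shanks : ∀ n → ∑ₛ (suc n) (term n n) ≈ pentagonal d n ⊕ X (pent⁻ n)
    shanks-carry : ∀ n → ∑ₛ (suc n) (term (suc n) (suc n)) ≈ pentagonal d (suc n)

    shanks zero    k l = cong (0ℙ ℙ.+_) (*-identityˡ (X 0) k l)
    shanks (suc n) = ⊕-cong (shanks-carry n)
      (≈-trans (λ k _ → cong (λ i → (between i (suc n) ⊗ X (pent⁻ (suc n))) k) (ℕ.n∸n≡0 n)) (*-identityˡ (X (pent⁻ (suc n)))))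
    shanks-carry n = begin
      ∑ₛ (suc n) (term (suc n) (suc n))           ≈⟨ telescope n (suc n) ℕ.≤-refl ⟩
      ∑ₛ (suc n) (term n n) ⊕ carry n (suc n)     ≈⟨ ⊕-cong (shanks n) (carry-end n) ⟩
      pentagonal d n ⊕ X (pent⁻ n) ⊕ X (pent⁺ n)  ≈⟨ (λ k _ → ℙ.+-assoc (pentagonal d n k) _ _) ⟩
      pentagonal d (suc n) ∎

    X≈0 : 1 ℕ.≤ d → ∀ {e} → m ℕ.< e → X e ≈ 0ₛ
    X≈0 1≤d {e} m<e = mono≈0 (ℕ.<-≤-trans m<e (ℕ.≤-trans (ℕ.≤-reflexive (sym (ℕ.*-identityˡ e))) (ℕ.*-monoˡ-≤ e 1≤d)))

    ∑ₛ-first : ∀ F K → (∀ s → F (suc s) ≈ 0ₛ) → ∑ₛ (suc K) F ≈ F 0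
    ∑ₛ-first F zero    _ n l = refl
    ∑ₛ-first F (suc K) p = ≈-trans (⊕-cong (∑ₛ-first F K p) (p K)) (+-identityʳ (F 0))

    product-stable : 1 ℕ.≤ d → ∀ k → product d (k ℕ.+ m) ≈ product d m
    product-stable 1≤d zero    = ≈-refl
    product-stable 1≤d (suc k) = begin
      (1ₛ ⊕ X (suc (k ℕ.+ m))) ⊗ product d (k ℕ.+ m)
        ≈⟨ ⊗-cong (⊕-congˡ {1ₛ} (X≈0 1≤d (s≤s (ℕ.m≤n+m m k)))) (product-stable 1≤d k) ⟩
      (1ₛ ⊕ 0ₛ) ⊗ product d m ≈⟨ solve 1 (λ a → (con 1 :+ con 0) :* a := a) ≈-refl (product d m) ⟩
      product d m ∎

    -- The free `k` widens the window at will, because a product of two theta series needs a common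
    -- window exceeding the degree.
    product≈pentagonal : 1 ℕ.≤ d → ∀ k → product d m ≈ pentagonal d (suc (k ℕ.+ m))
    product≈pentagonal 1≤d k = begin
      product d m       ≈⟨ product-stable 1≤d (suc k) ⟨
      product d (suc n) ≈⟨ product≈between (suc n) ⟩
      between (suc n) 0 ≈⟨ *-identityʳ (between (suc n) 0) ⟨
      between (suc n) 0 ⊗ 1ₛ ≈⟨ ⊗-congˡ {between (suc n) 0} X0≈1 ⟨
      term (suc n) (suc n) 0 ≈⟨ ∑ₛ-first (term (suc n) (suc n)) n higher ⟨
      ∑ₛ (suc n) (term (suc n) (suc n)) ≈⟨ shanks-carry n ⟩
      pentagonal d (suc n) ∎
      where
      n = k ℕ.+ m
      higher : ∀ s → term (suc n) (suc n) (suc s) ≈ 0ₛ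
      higher s = ≈-trans (⊗-congˡ {between (n ℕ.∸ s) (suc s)} (X≈0 1≤d
        (ℕ.<-≤-trans (s≤s (ℕ.m≤n+m m k)) (ℕ.≤-trans (ℕ.m≤m+n (suc n) (s ℕ.* suc n)) (ℕ.m≤m+n _ (tri (suc s)))))))
        (zeroʳ (between (n ℕ.∸ s) (suc s)))

-- Products of two theta series

∑-+ : ∀ K f g → ∑ K (λ i → f i ℙ.+ g i) ≡ ∑ K f ℙ.+ ∑ K g
∑-+ zero    f g = refl
∑-+ (suc K) f g = trans (cong (ℙ._+ (f K ℙ.+ g K)) (∑-+ K f g)) (interchange (∑ K f) (∑ K g) (f K) (g K))

∑-swap : ∀ J K (F : ℕ → ℕ → Parity) → ∑ J (λ j → ∑ K (F j)) ≡ ∑ K (λ k → ∑ J (λ j → F j k))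
∑-swap zero    K F = sym (∑-zero K (λ _ _ → refl))
∑-swap (suc J) K F = trans (cong (ℙ._+ ∑ K (F J)) (∑-swap J K F)) (sym (∑-+ K (λ k → ∑ J (λ j → F j k)) (F J)))

∑-first : ∀ K f → ∑ (suc K) f ≡ f 0 ℙ.+ ∑ K (f ∘ suc)
∑-first zero    f = sym (ℙ.+-identityʳ (f 0))
∑-first (suc K) f = trans (cong (ℙ._+ f (suc K)) (∑-first K f)) (ℙ.+-assoc (f 0) (∑ K (f ∘ suc)) (f (suc K)))

∑-split : ∀ J K f → ∑ (J ℕ.+ K) f ≡ ∑ J f ℙ.+ ∑ K (λ i → f (J ℕ.+ i))
∑-split J zero    f = trans (cong (λ n → ∑ n f) (ℕ.+-identityʳ J)) (sym (ℙ.+-identityʳ (∑ J f)))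
∑-split J (suc K) f = begin
  ∑ (J ℕ.+ suc K) f ≡⟨ cong (λ n → ∑ n f) (ℕ.+-suc J K) ⟩
  ∑ (J ℕ.+ K) f ℙ.+ f (J ℕ.+ K) ≡⟨ cong (ℙ._+ f (J ℕ.+ K)) (∑-split J K f) ⟩
  ∑ J f ℙ.+ ∑ K (λ i → f (J ℕ.+ i)) ℙ.+ f (J ℕ.+ K) ≡⟨ ℙ.+-assoc (∑ J f) _ _ ⟩
  ∑ J f ℙ.+ ∑ (suc K) (λ i → f (J ℕ.+ i)) ∎
  where open ≡-Reasoning

∑-*3 : ∀ K f → ∑ (K ℕ.* 3) f ≡ ∑ K (λ i → f (i ℕ.* 3) ℙ.+ f (1 ℕ.+ i ℕ.* 3) ℙ.+ f (2 ℕ.+ i ℕ.* 3))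
∑-*3 zero    f = refl
∑-*3 (suc K) f = begin
  ∑ (K ℕ.* 3) f ℙ.+ a ℙ.+ b ℙ.+ c     ≡⟨ cong (ℙ._+ c) (ℙ.+-assoc (∑ (K ℕ.* 3) f) a b) ⟩
  ∑ (K ℕ.* 3) f ℙ.+ (a ℙ.+ b) ℙ.+ c   ≡⟨ ℙ.+-assoc (∑ (K ℕ.* 3) f) (a ℙ.+ b) c ⟩
  ∑ (K ℕ.* 3) f ℙ.+ (a ℙ.+ b ℙ.+ c)   ≡⟨ cong (ℙ._+ (a ℙ.+ b ℙ.+ c)) (∑-*3 K f) ⟩
  _ ∎
  where
  open ≡-Reasoning
  a = f (K ℕ.* 3)
  b = f (1 ℕ.+ K ℕ.* 3)
  c = f (2 ℕ.+ K ℕ.* 3)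

∑-double : ∀ K f → ∑ (double K) f ≡ ∑ K (λ i → f (double i) ℙ.+ f (suc (double i)))
∑-double zero    f = refl
∑-double (suc K) f = trans (ℙ.+-assoc (∑ (double K) f) _ _)
  (cong (ℙ._+ (f (double K) ℙ.+ f (suc (double K)))) (∑-double K f))

-- Invariance under i ↦ p - 1 - i, phrased without subtraction.
Palindromic : ℕ → (ℕ → Parity) → Set
Palindromic p f = ∀ i j → suc (i ℕ.+ j) ≡ p → f i ≡ f j

∑-peel : ∀ p f → Palindromic (suc (suc p)) f → ∑ (suc (suc p)) f ≡ ∑ p (f ∘ suc)
∑-peel p f pal = begin
  ∑ (suc p) f ℙ.+ f (suc p)           ≡⟨ cong (ℙ._+ f (suc p)) (∑-first p f) ⟩
  f 0 ℙ.+ ∑ p (f ∘ suc) ℙ.+ f (suc p) ≡⟨ cong (λ a → a ℙ.+ ∑ p (f ∘ suc) ℙ.+ f (suc p)) (pal 0 (suc p) refl) ⟩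
  f (suc p) ℙ.+ ∑ p (f ∘ suc) ℙ.+ f (suc p) ≡⟨ cong (ℙ._+ f (suc p)) (ℙ.+-comm (f (suc p)) _) ⟩
  ∑ p (f ∘ suc) ℙ.+ f (suc p) ℙ.+ f (suc p) ≡⟨ ℙ.+-assoc (∑ p (f ∘ suc)) _ _ ⟩
  ∑ p (f ∘ suc) ℙ.+ (f (suc p) ℙ.+ f (suc p)) ≡⟨ cong (∑ p (f ∘ suc) ℙ.+_) (ℙ.p+p≡0ℙ (f (suc p))) ⟩
  ∑ p (f ∘ suc) ℙ.+ 0ℙ ≡⟨ ℙ.+-identityʳ _ ⟩
  ∑ p (f ∘ suc) ∎
  where open ≡-Reasoning

palindromic-tail : ∀ {p f} → Palindromic (suc (suc p)) f → Palindromic p (f ∘ suc)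
palindromic-tail pal i j refl = pal (suc i) (suc j) (cong (suc ∘ suc) (ℕ.+-suc i j))

∑-palindromic-even : ∀ r f → Palindromic (double r) f → ∑ (double r) f ≡ 0ℙ
∑-palindromic-even zero    f pal = refl
∑-palindromic-even (suc r) f pal =
  trans (∑-peel (double r) f pal) (∑-palindromic-even r (f ∘ suc) (palindromic-tail pal))

∑-palindromic-odd : ∀ r f → Palindromic (suc (double r)) f → ∑ (suc (double r)) f ≡ f r
∑-palindromic-odd zero    f pal = refl
∑-palindromic-odd (suc r) f pal =
  trans (∑-peel (suc (double r)) f pal) (∑-palindromic-odd r (f ∘ suc) (palindromic-tail pal))

-- The window 1 - K ≤ v ≤ K of ℤ, arranged so that v ↦ 1 - v preserves it.
∑ℤ : ℕ → (ℤ → Parity) → Parity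
∑ℤ K φ = ∑ K (λ i → φ (+ suc i) ℙ.+ φ (ℤ.- + i))

∑ℤ-cong : ∀ K {φ ψ} → (∀ v → φ v ≡ ψ v) → ∑ℤ K φ ≡ ∑ℤ K ψ
∑ℤ-cong K p = ∑-cong K (λ i _ → cong₂ ℙ._+_ (p (+ suc i)) (p (ℤ.- + i)))

∑ℤ-zero : ∀ K {φ} → (∀ v → φ v ≡ 0ℙ) → ∑ℤ K φ ≡ 0ℙ
∑ℤ-zero K p = ∑-zero K (λ i _ → cong₂ ℙ._+_ (p (+ suc i)) (p (ℤ.- + i)))

1-[1+] : ∀ i → + 1 ℤ.- (+ 1 ℤ.+ i) ≡ ℤ.- i
1-[1+] = solve-ℤ

1-neg : ∀ i → + 1 ℤ.- (ℤ.- i) ≡ + 1 ℤ.+ i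
1-neg = solve-ℤ

∑ℤ-reflect : ∀ K φ → ∑ℤ K (λ v → φ (+ 1 ℤ.- v)) ≡ ∑ℤ K φ
∑ℤ-reflect K φ = ∑-cong K (λ i _ →
  trans (cong₂ (λ u v → φ u ℙ.+ φ v) (1-[1+] (+ i)) (1-neg (+ i))) (ℙ.+-comm (φ (ℤ.- + i)) (φ (+ suc i))))

∑ℤ-symmetric : ∀ K φ → (∀ v → φ (+ 1 ℤ.- v) ≡ φ v) → ∑ℤ K φ ≡ 0ℙ
∑ℤ-symmetric K φ s = ∑-zero K (λ i _ →
  trans (cong (φ (+ suc i) ℙ.+_) (trans (cong φ (sym (1-[1+] (+ i)))) (s (+ suc i)))) (ℙ.p+p≡0ℙ (φ (+ suc i))))

cancel : ∀ a b c → a ℙ.+ b ℙ.+ (c ℙ.+ b) ≡ a ℙ.+ c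
cancel a b c = trans (interchange a b c b) (trans (cong (a ℙ.+ c ℙ.+_) (ℙ.p+p≡0ℙ b)) (ℙ.+-identityʳ _))

-- The shift moves the window from [1 - K, K] to [2 - K, K + 1], so one end is gained and the other
-- lost; modulo 2 a loss is also an addition.
∑ℤ-suc : ∀ K φ → ∑ℤ K (λ v → φ (+ 1 ℤ.+ v)) ≡ ∑ℤ K φ ℙ.+ φ (+ suc K) ℙ.+ φ (+ 1 ℤ.- + K)
∑ℤ-suc zero    φ = sym (ℙ.p+p≡0ℙ (φ (+ 1)))
∑ℤ-suc (suc K) φ = begin
  ∑ℤ K (λ v → φ (+ 1 ℤ.+ v)) ℙ.+ (r ℙ.+ q) ≡⟨ cong (ℙ._+ (r ℙ.+ q)) (∑ℤ-suc K φ) ⟩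
  s ℙ.+ p ℙ.+ q ℙ.+ (r ℙ.+ q)             ≡⟨ cancel (s ℙ.+ p) q r ⟩
  s ℙ.+ p ℙ.+ r                           ≡⟨ cancel (s ℙ.+ p) t r ⟨
  s ℙ.+ p ℙ.+ t ℙ.+ (r ℙ.+ t)             ≡⟨ ℙ.+-assoc (s ℙ.+ p ℙ.+ t) r t ⟨
  s ℙ.+ p ℙ.+ t ℙ.+ r ℙ.+ t               ≡⟨ cong (λ x → x ℙ.+ r ℙ.+ t) (ℙ.+-assoc s p t) ⟩
  s ℙ.+ (p ℙ.+ t) ℙ.+ r ℙ.+ t             ≡⟨ cong (λ v → s ℙ.+ (p ℙ.+ t) ℙ.+ r ℙ.+ φ v) (1-[1+] (+ K)) ⟨
  s ℙ.+ (p ℙ.+ t) ℙ.+ r ℙ.+ φ (+ 1 ℤ.- + suc K) ∎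
  where
  open ≡-Reasoning
  s = ∑ℤ K φ
  p = φ (+ suc K)
  q = φ (+ 1 ℤ.- + K)
  r = φ (+ suc (suc K))
  t = φ (ℤ.- + K)

∣1-suc∣ : ∀ K → ∣ + 1 ℤ.- + suc K ∣ ≡ K
∣1-suc∣ K = trans (cong ∣_∣ (1-[1+] (+ K))) (ℤ.∣-i∣≡∣i∣ (+ K))

-- With the window of size `suc K` the two end terms sit at K + 2 and -K, both in the range where φ
-- vanishes.
∑ℤ-shift : ∀ K φ → (∀ v → K ℕ.≤ ∣ v ∣ → φ v ≡ 0ℙ) → ∑ℤ (suc K) (λ v → φ (+ 1 ℤ.+ v)) ≡ ∑ℤ (suc K) φ
∑ℤ-shift K φ vanish = begin
  ∑ℤ (suc K) (λ v → φ (+ 1 ℤ.+ v)) ≡⟨ ∑ℤ-suc (suc K) φ ⟩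
  ∑ℤ (suc K) φ ℙ.+ φ (+ suc (suc K)) ℙ.+ φ (+ 1 ℤ.- + suc K)
    ≡⟨ cong₂ (λ a b → ∑ℤ (suc K) φ ℙ.+ a ℙ.+ b) (vanish _ (ℕ.m≤n+m K 2)) (vanish _ (ℕ.≤-reflexive (sym (∣1-suc∣ K)))) ⟩
  ∑ℤ (suc K) φ ℙ.+ 0ℙ ℙ.+ 0ℙ ≡⟨ ℙ.+-identityʳ _ ⟩
  ∑ℤ (suc K) φ ℙ.+ 0ℙ ≡⟨ ℙ.+-identityʳ _ ⟩
  ∑ℤ (suc K) φ ∎
  where open ≡-Reasoning

-- The quadratic form: symmetries and growth

δ : ℤ → Parity
δ (+ zero)  = 1ℙ
δ (+ suc _) = 0ℙ
δ -[1+ _ ]  = 0ℙ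

δ-≢0 : ∀ {z} → ¬ (z ≡ + 0) → δ z ≡ 0ℙ
δ-≢0 {+ zero}   z≢0 = ⊥-elim (z≢0 refl)
δ-≢0 {+ suc _}  _   = refl
δ-≢0 { -[1+ _ ]} _   = refl

δ-2* : ∀ z → δ (+ 2 ℤ.* z) ≡ δ z
δ-2* (+ zero)  = refl
δ-2* (+ suc _) = refl
δ-2* -[1+ _ ]  = refl

δ-mono : ∀ d n → δ (+ d ℤ.- + n) ≡ mono d n
δ-mono d n = trans (cong δ (ℤ.m-n≡m⊖n d n)) (⊖-mono d n)
  where
  ⊖-mono : ∀ d n → δ (d ℤ.⊖ n) ≡ mono d n
  ⊖-mono zero    zero    = refl
  ⊖-mono zero    (suc n) = refl
  ⊖-mono (suc d) zero    = refl
  ⊖-mono (suc d) (suc n) = trans (cong δ (ℤ.[1+m]⊖[1+n]≡m⊖n d n)) (⊖-mono d n)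

-- Twice a j(j+1)/2 - jv + v(3v-1)/2.
form : ℤ → ℤ → ℤ → ℤ
form a j v = a ℤ.* (j ℤ.* (j ℤ.+ + 1)) ℤ.- + 2 ℤ.* (j ℤ.* v) ℤ.+ v ℤ.* (+ 3 ℤ.* v ℤ.- + 1)

-- The coefficient of q^{D h(j,v)} at degree M, with both sides doubled so that nothing is halved. M
-- is an integer because shifting rows can push it below 0, where the coefficient is simply 0.
[_*form_at_,_]≟_ : ℤ → ℤ → ℤ → ℤ → ℤ → Parity
[ D *form a at j , v ]≟ M = δ (D ℤ.* form a j v ℤ.- + 2 ℤ.* M)

-- The difference h(j + 3, v + 1) - h(j, v) = (3a - 1)(j + 2) is free of v, so a whole row moves by
-- one power of q. This is where c = 3a - 1 comes from.
form-shift : ∀ D a j v M → [ D *form a at + 3 ℤ.+ j , + 1 ℤ.+ v ]≟ M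
                         ≡ [ D *form a at j , v ]≟ (M ℤ.- (+ 3 ℤ.* a ℤ.- + 1) ℤ.* D ℤ.* (j ℤ.+ + 2))
form-shift D a j v M = cong δ (identity D a j v M)
  where
  identity : ∀ D a j v M → D ℤ.* (a ℤ.* ((+ 3 ℤ.+ j) ℤ.* ((+ 3 ℤ.+ j) ℤ.+ + 1)) ℤ.- + 2 ℤ.* ((+ 3 ℤ.+ j) ℤ.* (+ 1 ℤ.+ v)) ℤ.+ (+ 1 ℤ.+ v) ℤ.* (+ 3 ℤ.* (+ 1 ℤ.+ v) ℤ.- + 1)) ℤ.- + 2 ℤ.* M
    ≡ D ℤ.* (a ℤ.* (j ℤ.* (j ℤ.+ + 1)) ℤ.- + 2 ℤ.* (j ℤ.* v) ℤ.+ v ℤ.* (+ 3 ℤ.* v ℤ.- + 1)) ℤ.- + 2 ℤ.* (M ℤ.- (+ 3 ℤ.* a ℤ.- + 1) ℤ.* D ℤ.* (j ℤ.+ + 2))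
  identity = solve-ℤ

-- At j = 1 the terms in v combine to 3v(v - 1).
form-1 : ∀ D a v M → [ D *form a at + 1 , + 1 ℤ.- v ]≟ M ≡ [ D *form a at + 1 , v ]≟ M
form-1 D a v M = cong δ (identity D a v M)
  where
  identity : ∀ D a v M → D ℤ.* (a ℤ.* (+ 1 ℤ.* (+ 1 ℤ.+ + 1)) ℤ.- + 2 ℤ.* (+ 1 ℤ.* (+ 1 ℤ.- v)) ℤ.+ (+ 1 ℤ.- v) ℤ.* (+ 3 ℤ.* (+ 1 ℤ.- v) ℤ.- + 1)) ℤ.- + 2 ℤ.* M
    ≡ D ℤ.* (a ℤ.* (+ 1 ℤ.* (+ 1 ℤ.+ + 1)) ℤ.- + 2 ℤ.* (+ 1 ℤ.* v) ℤ.+ v ℤ.* (+ 3 ℤ.* v ℤ.- + 1)) ℤ.- + 2 ℤ.* M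
  identity = solve-ℤ

form-2 : ∀ D a v M → [ D *form a at + 2 , v ]≟ M ≡ [ D *form a at + 0 , + 1 ℤ.- v ]≟ (M ℤ.- (+ 3 ℤ.* a ℤ.- + 1) ℤ.* D)
form-2 D a v M = cong δ (identity D a v M)
  where
  identity : ∀ D a v M → D ℤ.* (a ℤ.* (+ 2 ℤ.* (+ 2 ℤ.+ + 1)) ℤ.- + 2 ℤ.* (+ 2 ℤ.* v) ℤ.+ v ℤ.* (+ 3 ℤ.* v ℤ.- + 1)) ℤ.- + 2 ℤ.* M
    ≡ D ℤ.* (a ℤ.* (+ 0 ℤ.* (+ 0 ℤ.+ + 1)) ℤ.- + 2 ℤ.* (+ 0 ℤ.* (+ 1 ℤ.- v)) ℤ.+ (+ 1 ℤ.- v) ℤ.* (+ 3 ℤ.* (+ 1 ℤ.- v) ℤ.- + 1)) ℤ.- + 2 ℤ.* (M ℤ.- (+ 3 ℤ.* a ℤ.- + 1) ℤ.* D)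
  identity = solve-ℤ

oblong : ℤ → ℕ
oblong (+ n)    = n ℕ.* suc n
oblong -[1+ n ] = n ℕ.* suc n

oblong-spec : ∀ k → k ℤ.* (k ℤ.+ + 1) ≡ + oblong k
oblong-spec (+ n)    = trans (cong (+ n ℤ.*_) (cong +_ (ℕ.+-comm n 1))) (sym (ℤ.pos-* n (suc n)))
oblong-spec -[1+ n ] = trans (identity (+ n)) (sym (ℤ.pos-* n (suc n)))
  where
  identity : ∀ n → ℤ.- (+ 1 ℤ.+ n) ℤ.* (ℤ.- (+ 1 ℤ.+ n) ℤ.+ + 1) ≡ n ℤ.* (+ 1 ℤ.+ n)
  identity = solve-ℤ

square-spec : ∀ k → k ℤ.* k ≡ + (∣ k ∣ ℕ.* ∣ k ∣)
square-spec (+ n)    = sym (ℤ.pos-* n n)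
square-spec -[1+ n ] = refl

-- Here `a` stands for a - 1. The decomposition (a - 1) j(j + 1) + (j - v)(j - v + 1) + 2v² has
-- nonnegative summands, so it is a natural number and grows with j and with v; this confines each
-- degree to a finite window.
formℕ : ℕ → ℕ → ℤ → ℕ
formℕ a j v = a ℕ.* (j ℕ.* suc j) ℕ.+ oblong (+ j ℤ.- v) ℕ.+ 2 ℕ.* (∣ v ∣ ℕ.* ∣ v ∣)

form-spec : ∀ a j v → form (+ suc a) (+ j) v ≡ + formℕ a j v
form-spec a j v = begin
  form (+ 1 ℤ.+ + a) (+ j) v ≡⟨ identity (+ a) (+ j) v ⟩
  + a ℤ.* (+ j ℤ.* (+ j ℤ.+ + 1)) ℤ.+ (+ j ℤ.- v) ℤ.* ((+ j ℤ.- v) ℤ.+ + 1) ℤ.+ + 2 ℤ.* (v ℤ.* v)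
    ≡⟨ cong₂ ℤ._+_ (cong₂ ℤ._+_ (cong (+ a ℤ.*_) (oblong-spec (+ j))) (oblong-spec (+ j ℤ.- v))) (cong (+ 2 ℤ.*_) (square-spec v)) ⟩
  + a ℤ.* + (j ℕ.* suc j) ℤ.+ + oblong (+ j ℤ.- v) ℤ.+ + 2 ℤ.* + (∣ v ∣ ℕ.* ∣ v ∣)
    ≡⟨ cong₂ (λ x y → x ℤ.+ + oblong (+ j ℤ.- v) ℤ.+ y) (sym (ℤ.pos-* a (j ℕ.* suc j))) (sym (ℤ.pos-* 2 (∣ v ∣ ℕ.* ∣ v ∣))) ⟩
  + formℕ a j v ∎
  where
  open ≡-Reasoning
  identity : ∀ a j v → (+ 1 ℤ.+ a) ℤ.* (j ℤ.* (j ℤ.+ + 1)) ℤ.- + 2 ℤ.* (j ℤ.* v) ℤ.+ v ℤ.* (+ 3 ℤ.* v ℤ.- + 1)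
    ≡ a ℤ.* (j ℤ.* (j ℤ.+ + 1)) ℤ.+ (j ℤ.- v) ℤ.* ((j ℤ.- v) ℤ.+ + 1) ℤ.+ + 2 ℤ.* (v ℤ.* v)
  identity = solve-ℤ

double<oblong : ∀ n N → N ℕ.< n → N ℕ.+ N ℕ.< n ℕ.* suc n
double<oblong n@(suc k) N N<n = begin-strict
  N ℕ.+ N     <⟨ ℕ.+-mono-<-≤ N<n (ℕ.<⇒≤ N<n) ⟩
  n ℕ.+ n     ≡⟨ doubling n ⟩
  n ℕ.* 2     ≤⟨ ℕ.*-monoʳ-≤ n (s≤s (s≤s z≤n)) ⟩
  n ℕ.* suc n ∎
  where
  open ℕ.≤-Reasoning
  doubling : ∀ n → n ℕ.+ n ≡ n ℕ.* 2
  doubling = solve-ℕ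

formℕ-large-v : ∀ a j v N → N ℕ.< ∣ v ∣ → N ℕ.+ N ℕ.< formℕ a j v
formℕ-large-v a j v N N<v = begin-strict
  N ℕ.+ N                 <⟨ ℕ.+-mono-<-≤ N<v (ℕ.<⇒≤ N<v) ⟩
  ∣ v ∣ ℕ.+ ∣ v ∣         ≤⟨ ℕ.+-mono-≤ v≤v² (ℕ.≤-trans v≤v² (ℕ.m≤m+n _ 0)) ⟩
  2 ℕ.* (∣ v ∣ ℕ.* ∣ v ∣) ≤⟨ ℕ.m≤n+m _ (a ℕ.* (j ℕ.* suc j) ℕ.+ oblong (+ j ℤ.- v)) ⟩
  formℕ a j v             ∎
  where
  open ℕ.≤-Reasoning
  n≤n² : ∀ n → n ℕ.≤ n ℕ.* n
  n≤n² zero    = z≤n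
  n≤n² (suc n) = ℕ.m≤m*n (suc n) (suc n)
  v≤v² = n≤n² ∣ v ∣

oblong-difference : ∀ j v N → N ℕ.+ N ℕ.< j → ∣ v ∣ ℕ.≤ N → N ℕ.+ N ℕ.< oblong (+ j ℤ.- v)
oblong-difference j (+ p) N 2N<j p≤N rewrite ℤ.m-n≡m⊖n j p
  | ℤ.⊖-≥ (ℕ.≤-trans p≤N (ℕ.≤-trans (ℕ.m≤m+n N N) (ℕ.<⇒≤ 2N<j))) =
  double<oblong (j ℕ.∸ p) N (ℕ.m+n≤o⇒m≤o∸n (suc N) (ℕ.≤-trans (s≤s (ℕ.+-monoʳ-≤ N p≤N)) 2N<j))
oblong-difference j -[1+ p ] N 2N<j _ =
  double<oblong (j ℕ.+ suc p) N (ℕ.<-≤-trans (ℕ.≤-<-trans (ℕ.m≤m+n N N) 2N<j) (ℕ.m≤m+n j (suc p)))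

-- If v is at most N in absolute value then j - v > N, and the oblong summand alone is large enough;
-- otherwise 2v² is.
formℕ-large-j : ∀ a j v N → N ℕ.+ N ℕ.< j → N ℕ.+ N ℕ.< formℕ a j v
formℕ-large-j a j v N 2N<j with ∣ v ∣ ℕ.≤? N
... | yes v≤N = ℕ.<-≤-trans (oblong-difference j v N 2N<j v≤N)
                  (ℕ.≤-trans (ℕ.m≤n+m _ (a ℕ.* (j ℕ.* suc j))) (ℕ.m≤m+n _ _))
... | no  v≰N = formℕ-large-v a j v N (ℕ.≰⇒> v≰N)

form-vanish : ∀ d a j v M → 1 ℕ.≤ d → + 2 ℤ.* M ℤ.< + formℕ a j v → [ + d *form + suc a at + j , v ]≟ M ≡ 0ℙ
form-vanish d a j v M 1≤d small = δ-≢0 λ eq →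
  ℤ.<-irrefl (trans (sym (ℤ.i-j≡0⇒i≡j _ (+ 2 ℤ.* M) eq)) scaled) (ℤ.<-≤-trans small (ℤ.+≤+ F≤dF))
  where
  scaled : + d ℤ.* form (+ suc a) (+ j) v ≡ + (d ℕ.* formℕ a j v)
  scaled = trans (cong (+ d ℤ.*_) (form-spec a j v)) (sym (ℤ.pos-* d (formℕ a j v)))
  F≤dF : formℕ a j v ℕ.≤ d ℕ.* formℕ a j v
  F≤dF = ℕ.≤-trans (ℕ.≤-reflexive (sym (ℕ.*-identityˡ _))) (ℕ.*-monoˡ-≤ (formℕ a j v) 1≤d)

2*-bound : ∀ {M N F} → M ℤ.≤ + N → N ℕ.+ N ℕ.< F → + 2 ℤ.* M ℤ.< + F
2*-bound {M} {N} {F} M≤N 2N<F = ℤ.≤-<-trans (ℤ.*-monoˡ-≤-nonNeg (+ 2) M≤N)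
  (ℤ.≤-<-trans (ℤ.≤-reflexive (trans (sym (ℤ.pos-* 2 N)) (cong (λ x → + (N ℕ.+ x)) (ℕ.+-identityʳ N)))) (ℤ.+<+ 2N<F))

minus-minus : ∀ M x y → M ℤ.- x ℤ.- y ≡ M ℤ.- (y ℤ.+ x)
minus-minus = solve-ℤ

2*tri : ∀ n → 2 ℕ.* tri n ≡ n ℕ.* suc n
2*tri zero    = refl
2*tri (suc n) = trans (ℕ.*-distribˡ-+ 2 (tri n) (suc n)) (trans (cong (ℕ._+ 2 ℕ.* suc n) (2*tri n)) (identity n))
  where
  identity : ∀ n → n ℕ.* suc n ℕ.+ 2 ℕ.* suc n ≡ suc n ℕ.* suc (suc n)
  identity = solve-ℕ

+2*tri : ∀ n → + 2 ℤ.* + tri n ≡ + n ℤ.* (+ 1 ℤ.+ + n)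
+2*tri n = trans (sym (ℤ.pos-* 2 (tri n))) (trans (cong +_ (2*tri n)) (ℤ.pos-* n (suc n)))

∑ₛ-⊗ : ∀ K F g n → (∑ₛ K F ⊗ g) n ≡ ∑ K (λ i → (F i ⊗ g) n)
∑ₛ-⊗ zero    F g n = ⊗-zeroˡ g n
∑ₛ-⊗ (suc K) F g n = trans (⊗-distribʳ g (∑ₛ K F) (F K) n) (cong (ℙ._+ (F K ⊗ g) n) (∑ₛ-⊗ K F g n))

-- Without its end v = K + 1 the window is symmetric about 0, as pairing v with -v requires.
∑ℤ-fold : ∀ K φ → φ (+ suc K) ≡ 0ℙ
        → ∑ℤ (suc K) φ ≡ φ (+ 0) ℙ.+ ∑ K (λ i → φ (+ suc i) ℙ.+ φ -[1+ i ])
∑ℤ-fold K φ end = begin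
  ∑ℤ (suc K) φ ≡⟨ ∑-+ (suc K) (λ i → φ (+ suc i)) (λ i → φ (ℤ.- + i)) ⟩
  ∑ K p ℙ.+ φ (+ suc K) ℙ.+ ∑ (suc K) (λ i → φ (ℤ.- + i)) ≡⟨ cong₂ ℙ._+_ (trans (cong (∑ K p ℙ.+_) end) (ℙ.+-identityʳ (∑ K p))) (∑-first K (λ i → φ (ℤ.- + i))) ⟩
  ∑ K p ℙ.+ (φ (+ 0) ℙ.+ ∑ K n) ≡⟨ ℙ.+-assoc (∑ K p) (φ (+ 0)) (∑ K n) ⟨
  ∑ K p ℙ.+ φ (+ 0) ℙ.+ ∑ K n ≡⟨ cong (ℙ._+ ∑ K n) (ℙ.+-comm (∑ K p) (φ (+ 0))) ⟩
  φ (+ 0) ℙ.+ ∑ K p ℙ.+ ∑ K n ≡⟨ ℙ.+-assoc (φ (+ 0)) (∑ K p) (∑ K n) ⟩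
  φ (+ 0) ℙ.+ (∑ K p ℙ.+ ∑ K n) ≡⟨ cong (φ (+ 0) ℙ.+_) (∑-+ K p n) ⟨
  φ (+ 0) ℙ.+ ∑ K (λ i → p i ℙ.+ n i) ∎
  where
  open ≡-Reasoning
  p n : ℕ → Parity
  p i = φ (+ suc i)
  n i = φ -[1+ i ]

-- Padded with zeros up to J + p, the first sum covers the range [p, J + p) of the second one, and
-- the overlap cancels.
∑-overlap : ∀ J p g → (∀ j → J ℕ.≤ j → g j ≡ 0ℙ) → ∑ J g ℙ.+ ∑ J (λ j → g (p ℕ.+ j)) ≡ ∑ p g
∑-overlap J p g vanish = begin
  ∑ J g ℙ.+ s                     ≡⟨ cong (ℙ._+ s) (trans (cong (∑ J g ℙ.+_) (∑-zero p (λ i _ → vanish (J ℕ.+ i) (ℕ.m≤m+n J i)))) (ℙ.+-identityʳ (∑ J g))) ⟨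
  ∑ J g ℙ.+ ∑ p (λ i → g (J ℕ.+ i)) ℙ.+ s ≡⟨ cong (ℙ._+ s) (∑-split J p g) ⟨
  ∑ (J ℕ.+ p) g ℙ.+ s             ≡⟨ cong (λ n → ∑ n g ℙ.+ s) (ℕ.+-comm J p) ⟩
  ∑ (p ℕ.+ J) g ℙ.+ s             ≡⟨ cong (ℙ._+ s) (∑-split p J g) ⟩
  ∑ p g ℙ.+ s ℙ.+ s               ≡⟨ ℙ.+-assoc (∑ p g) s s ⟩
  ∑ p g ℙ.+ (s ℙ.+ s)             ≡⟨ cong (∑ p g ℙ.+_) (ℙ.p+p≡0ℙ s) ⟩
  ∑ p g ℙ.+ 0ℙ                    ≡⟨ ℙ.+-identityʳ _ ⟩
  ∑ p g                           ∎
  where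
  open ≡-Reasoning
  s = ∑ J (λ j → g (p ℕ.+ j))

-- The two sides differ by a multiple of ap - 2v. Exhibiting the cofactor avoids dividing by a;
-- `form-palindromic` works the same way.
form-neg : ∀ a p j v → a ℤ.* p ≡ + 2 ℤ.* v → form a (p ℤ.+ j) v ≡ form a j (ℤ.- v)
form-neg a p j v ap≡2v = begin
  form a (p ℤ.+ j) v ≡⟨ identity a p j v ⟩
  form a j (ℤ.- v) ℤ.+ (a ℤ.* p ℤ.- + 2 ℤ.* v) ℤ.* (p ℤ.+ + 2 ℤ.* j ℤ.+ + 1)
    ≡⟨ cong (λ x → form a j (ℤ.- v) ℤ.+ x ℤ.* (p ℤ.+ + 2 ℤ.* j ℤ.+ + 1)) (ℤ.i≡j⇒i-j≡0 ap≡2v) ⟩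
  form a j (ℤ.- v) ℤ.+ + 0 ≡⟨ ℤ.+-identityʳ _ ⟩
  form a j (ℤ.- v) ∎
  where
  open ≡-Reasoning
  identity : ∀ a p j v → a ℤ.* ((p ℤ.+ j) ℤ.* ((p ℤ.+ j) ℤ.+ + 1)) ℤ.- + 2 ℤ.* ((p ℤ.+ j) ℤ.* v) ℤ.+ v ℤ.* (+ 3 ℤ.* v ℤ.- + 1)
    ≡ a ℤ.* (j ℤ.* (j ℤ.+ + 1)) ℤ.- + 2 ℤ.* (j ℤ.* (ℤ.- v)) ℤ.+ (ℤ.- v) ℤ.* (+ 3 ℤ.* (ℤ.- v) ℤ.- + 1)
      ℤ.+ (a ℤ.* p ℤ.- + 2 ℤ.* v) ℤ.* (p ℤ.+ + 2 ℤ.* j ℤ.+ + 1)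
  identity = solve-ℤ

form-palindromic : ∀ a i j v → a ℤ.* (+ 1 ℤ.+ (i ℤ.+ j)) ≡ + 2 ℤ.* v → form a i v ≡ form a j v
form-palindromic a i j v eq = begin
  form a i v ≡⟨ identity a i j v ⟩
  form a j v ℤ.+ (a ℤ.* (+ 1 ℤ.+ (i ℤ.+ j)) ℤ.- + 2 ℤ.* v) ℤ.* (i ℤ.- j)
    ≡⟨ cong (λ x → form a j v ℤ.+ x ℤ.* (i ℤ.- j)) (ℤ.i≡j⇒i-j≡0 eq) ⟩
  form a j v ℤ.+ + 0 ≡⟨ ℤ.+-identityʳ _ ⟩
  form a j v ∎
  where
  open ≡-Reasoning
  identity : ∀ a i j v → a ℤ.* (i ℤ.* (i ℤ.+ + 1)) ℤ.- + 2 ℤ.* (i ℤ.* v) ℤ.+ v ℤ.* (+ 3 ℤ.* v ℤ.- + 1)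
    ≡ a ℤ.* (j ℤ.* (j ℤ.+ + 1)) ℤ.- + 2 ℤ.* (j ℤ.* v) ℤ.+ v ℤ.* (+ 3 ℤ.* v ℤ.- + 1)
      ℤ.+ (a ℤ.* (+ 1 ℤ.+ (i ℤ.+ j)) ℤ.- + 2 ℤ.* v) ℤ.* (i ℤ.- j)
  identity = solve-ℤ

form-0-pos : ∀ a i → form a (+ 0) (+ suc i) ≡ + 2 ℤ.* + pent⁺ i
form-0-pos a i = begin
  form a (+ 0) (+ 1 ℤ.+ + i) ≡⟨ identity a (+ i) ⟩
  + 2 ℤ.* (+ suc i ℤ.* + suc i) ℤ.+ + i ℤ.* (+ 1 ℤ.+ + i) ≡⟨ cong₂ (λ x y → + 2 ℤ.* x ℤ.+ y) (sym (ℤ.pos-* (suc i) (suc i))) (sym (+2*tri i)) ⟩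
  + 2 ℤ.* + (suc i ℕ.* suc i) ℤ.+ + 2 ℤ.* + tri i ≡⟨ ℤ.*-distribˡ-+ (+ 2) (+ (suc i ℕ.* suc i)) (+ tri i) ⟨
  + 2 ℤ.* + pent⁺ i ∎
  where
  open ≡-Reasoning
  identity : ∀ a i → a ℤ.* (+ 0 ℤ.* (+ 0 ℤ.+ + 1)) ℤ.- + 2 ℤ.* (+ 0 ℤ.* (+ 1 ℤ.+ i)) ℤ.+ (+ 1 ℤ.+ i) ℤ.* (+ 3 ℤ.* (+ 1 ℤ.+ i) ℤ.- + 1)
    ≡ + 2 ℤ.* ((+ 1 ℤ.+ i) ℤ.* (+ 1 ℤ.+ i)) ℤ.+ i ℤ.* (+ 1 ℤ.+ i)
  identity = solve-ℤ

form-0-neg : ∀ a i → form a (+ 0) (ℤ.- + i) ≡ + 2 ℤ.* + pent⁻ i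
form-0-neg a i = begin
  form a (+ 0) (ℤ.- + i) ≡⟨ identity a (+ i) ⟩
  + 2 ℤ.* (+ i ℤ.* + i) ℤ.+ + i ℤ.* (+ 1 ℤ.+ + i) ≡⟨ cong₂ (λ x y → + 2 ℤ.* x ℤ.+ y) (sym (ℤ.pos-* i i)) (sym (+2*tri i)) ⟩
  + 2 ℤ.* + (i ℕ.* i) ℤ.+ + 2 ℤ.* + tri i ≡⟨ ℤ.*-distribˡ-+ (+ 2) (+ (i ℕ.* i)) (+ tri i) ⟨
  + 2 ℤ.* + pent⁻ i ∎
  where
  open ≡-Reasoning
  identity : ∀ a i → a ℤ.* (+ 0 ℤ.* (+ 0 ℤ.+ + 1)) ℤ.- + 2 ℤ.* (+ 0 ℤ.* (ℤ.- i)) ℤ.+ (ℤ.- i) ℤ.* (+ 3 ℤ.* (ℤ.- i) ℤ.- + 1)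
    ≡ + 2 ℤ.* (i ℤ.* i) ℤ.+ i ℤ.* (+ 1 ℤ.+ i)
  identity = solve-ℤ

-- The coefficient a of the header is suc a here. Row 3n is q^{cd v(3v-1)/2} f_d at v = -n,
-- row 3n + 2 is the same at v = n + 1, and row 3n + 1 vanishes.
module ThetaProduct (d a : ℕ) (1≤d : 1 ℕ.≤ d) (N K : ℕ) (N<K : N ℕ.< K) where

  c : ℕ
  c = 2 ℕ.+ 3 ℕ.* a

  W : ℕ → ℤ → ℤ → Parity
  W j M v = [ + d *form + suc a at + j , v ]≟ M

  row : ℕ → ℤ → Parity
  row j M = ∑ℤ (suc K) (W j M)

  +c : + 3 ℤ.* + suc a ℤ.- + 1 ≡ + c
  +c = trans (identity (+ a)) (cong (λ x → + 2 ℤ.+ x) (sym (ℤ.pos-* 3 a)))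
    where
    identity : ∀ a → + 3 ℤ.* (+ 1 ℤ.+ a) ℤ.- + 1 ≡ + 2 ℤ.+ + 3 ℤ.* a
    identity = solve-ℤ

  W-large-v : ∀ j M v → M ℤ.≤ + N → N ℕ.< ∣ v ∣ → W j M v ≡ 0ℙ
  W-large-v j M v M≤N N<v = form-vanish d a j v M 1≤d (2*-bound M≤N (formℕ-large-v a j v N N<v))

  -- Stated for every M ≤ N because iteration lowers M; N < K keeps both ends of the window in the
  -- vanishing range.
  row-3+ : ∀ j M → M ℤ.≤ + N → row (3 ℕ.+ j) M ≡ row j (M ℤ.- + (c ℕ.* d ℕ.* (j ℕ.+ 2)))
  row-3+ j M M≤N = begin
    row (3 ℕ.+ j) M
      ≡⟨ ∑ℤ-shift K (W (3 ℕ.+ j) M) (λ v K≤v → W-large-v (3 ℕ.+ j) M v M≤N (ℕ.<-≤-trans N<K K≤v)) ⟨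
    ∑ℤ (suc K) (λ v → W (3 ℕ.+ j) M (+ 1 ℤ.+ v)) ≡⟨ ∑ℤ-cong (suc K) (λ v → form-shift (+ d) (+ suc a) (+ j) v M) ⟩
    row j (M ℤ.- (+ 3 ℤ.* + suc a ℤ.- + 1) ℤ.* + d ℤ.* + (j ℕ.+ 2)) ≡⟨ cong (λ x → row j (M ℤ.- x)) cast ⟩
    row j (M ℤ.- + (c ℕ.* d ℕ.* (j ℕ.+ 2))) ∎
    where
    open ≡-Reasoning
    cast : (+ 3 ℤ.* + suc a ℤ.- + 1) ℤ.* + d ℤ.* + (j ℕ.+ 2) ≡ + (c ℕ.* d ℕ.* (j ℕ.+ 2))
    cast = trans (cong (ℤ._* + (j ℕ.+ 2)) (trans (cong (ℤ._* + d) +c) (sym (ℤ.pos-* c d)))) (sym (ℤ.pos-* (c ℕ.* d) (j ℕ.+ 2)))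

  row-1 : ∀ M → row 1 M ≡ 0ℙ
  row-1 M = ∑ℤ-symmetric (suc K) (W 1 M) (λ v → form-1 (+ d) (+ suc a) v M)

  row-2 : ∀ M → row 2 M ≡ row 0 (M ℤ.- + (c ℕ.* d))
  row-2 M = begin
    row 2 M ≡⟨ ∑ℤ-cong (suc K) (λ v → form-2 (+ d) (+ suc a) v M) ⟩
    ∑ℤ (suc K) (λ v → W 0 M′ (+ 1 ℤ.- v)) ≡⟨ ∑ℤ-reflect (suc K) (W 0 M′) ⟩
    row 0 M′ ≡⟨ cong (λ x → row 0 (M ℤ.- x)) (trans (cong (ℤ._* + d) +c) (sym (ℤ.pos-* c d))) ⟩
    row 0 (M ℤ.- + (c ℕ.* d)) ∎
    where
    open ≡-Reasoning
    M′ = M ℤ.- (+ 3 ℤ.* + suc a ℤ.- + 1) ℤ.* + d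

  -- One induction for the residues 0 and 2. Row h n + 3 is row h n delayed by c d (h n + 2), so the
  -- exponents f must grow by h n + 2, as `pent⁻` does along 3n and `pent⁺` along 3n + 2.
  row-progression : ∀ (h f : ℕ → ℕ) → (∀ n → h (suc n) ≡ 3 ℕ.+ h n) → (∀ n → f n ℕ.+ (h n ℕ.+ 2) ≡ f (suc n))
                  → (∀ M → row (h 0) M ≡ row 0 (M ℤ.- + (c ℕ.* d ℕ.* f 0)))
                  → ∀ n M → M ℤ.≤ + N → row (h n) M ≡ row 0 (M ℤ.- + (c ℕ.* d ℕ.* f n))
  row-progression h f h-step f-step base zero    M _   = base M
  row-progression h f h-step f-step base (suc n) M M≤N = begin
    row (h (suc n)) M                       ≡⟨ cong (λ j → row j M) (h-step n) ⟩
    row (3 ℕ.+ h n) M                       ≡⟨ row-3+ (h n) M M≤N ⟩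
    row (h n) (M ℤ.- + x)                   ≡⟨ row-progression h f h-step f-step base n (M ℤ.- + x) (ℤ.i≤j⇒i-k≤j (+ x) M≤N) ⟩
    row 0 (M ℤ.- + x ℤ.- + (c ℕ.* d ℕ.* f n)) ≡⟨ cong (row 0) (minus-minus M (+ x) (+ (c ℕ.* d ℕ.* f n))) ⟩
    row 0 (M ℤ.- + (c ℕ.* d ℕ.* f n ℕ.+ x)) ≡⟨ cong (λ e → row 0 (M ℤ.- + e)) (sym (ℕ.*-distribˡ-+ (c ℕ.* d) (f n) (h n ℕ.+ 2))) ⟩
    row 0 (M ℤ.- + (c ℕ.* d ℕ.* (f n ℕ.+ (h n ℕ.+ 2)))) ≡⟨ cong (λ e → row 0 (M ℤ.- + (c ℕ.* d ℕ.* e))) (f-step n) ⟩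
    row 0 (M ℤ.- + (c ℕ.* d ℕ.* f (suc n))) ∎
    where
    open ≡-Reasoning
    x = c ℕ.* d ℕ.* (h n ℕ.+ 2)

  row-0-mod-3 : ∀ n → row (n ℕ.* 3) (+ N) ≡ row 0 (+ N ℤ.- + (c ℕ.* d ℕ.* pent⁻ n))
  row-0-mod-3 n = row-progression (ℕ._* 3) pent⁻ (λ _ → refl) (λ n → identity n (tri n))
    (λ M → cong (row 0) (sym (trans (cong (λ e → M ℤ.- + e) (ℕ.*-zeroʳ (c ℕ.* d))) (ℤ.+-identityʳ M)))) n (+ N) ℤ.≤-refl
    where
    identity : ∀ n T → n ℕ.* n ℕ.+ T ℕ.+ (n ℕ.* 3 ℕ.+ 2) ≡ suc n ℕ.* suc n ℕ.+ (T ℕ.+ suc n)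
    identity = solve-ℕ

  row-2-mod-3 : ∀ n → row (2 ℕ.+ n ℕ.* 3) (+ N) ≡ row 0 (+ N ℤ.- + (c ℕ.* d ℕ.* pent⁺ n))
  row-2-mod-3 n = row-progression (λ n → 2 ℕ.+ n ℕ.* 3) pent⁺ (λ _ → refl) (λ n → identity n (tri n))
    (λ M → trans (row-2 M) (cong (λ e → row 0 (M ℤ.- + e)) (sym (ℕ.*-identityʳ (c ℕ.* d))))) n (+ N) ℤ.≤-refl
    where
    identity : ∀ n T → suc n ℕ.* suc n ℕ.+ T ℕ.+ (2 ℕ.+ n ℕ.* 3 ℕ.+ 2) ≡ suc (suc n) ℕ.* suc (suc n) ℕ.+ (T ℕ.+ suc n)
    identity = solve-ℕ

  row-1-mod-3 : ∀ n M → M ℤ.≤ + N → row (1 ℕ.+ n ℕ.* 3) M ≡ 0ℙ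
  row-1-mod-3 zero    M _   = row-1 M
  row-1-mod-3 (suc n) M M≤N = trans (row-3+ (1 ℕ.+ n ℕ.* 3) M M≤N)
    (row-1-mod-3 n _ (ℤ.i≤j⇒i-k≤j (+ (c ℕ.* d ℕ.* (1 ℕ.+ n ℕ.* 3 ℕ.+ 2))) M≤N))

  W-value : ∀ r j v T → form (+ suc a) (+ j) v ≡ + 2 ℤ.* + T → W j (+ r) v ≡ mono (d ℕ.* T) r
  W-value r j v T value = begin
    W j (+ r) v                               ≡⟨ cong (λ x → δ (+ d ℤ.* x ℤ.- + 2 ℤ.* + r)) value ⟩
    δ (+ d ℤ.* (+ 2 ℤ.* + T) ℤ.- + 2 ℤ.* + r) ≡⟨ cong δ (halve (+ d) (+ T) (+ r)) ⟩
    δ (+ 2 ℤ.* (+ d ℤ.* + T ℤ.- + r))         ≡⟨ δ-2* (+ d ℤ.* + T ℤ.- + r) ⟩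
    δ (+ d ℤ.* + T ℤ.- + r)                   ≡⟨ cong (λ x → δ (x ℤ.- + r)) (ℤ.pos-* d T) ⟨
    δ (+ (d ℕ.* T) ℤ.- + r)                   ≡⟨ δ-mono (d ℕ.* T) r ⟩
    mono (d ℕ.* T) r                          ∎
    where
    open ≡-Reasoning
    halve : ∀ D T r → D ℤ.* (+ 2 ℤ.* T) ℤ.- + 2 ℤ.* r ≡ + 2 ℤ.* (D ℤ.* T ℤ.- r)
    halve = solve-ℤ

  row-0 : ∀ r → row 0 (+ r) ≡ pentagonal d (suc K) r
  row-0 r = ∑-cong (suc K) λ i _ → trans
    (cong₂ ℙ._+_
      (W-value r 0 (+ suc i) (pent⁺ i) (form-0-pos (+ suc a) i))
      (W-value r 0 (ℤ.- + i) (pent⁻ i) (form-0-neg (+ suc a) i)))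
    (ℙ.+-comm (mono (d ℕ.* pent⁺ i) r) (mono (d ℕ.* pent⁻ i) r))

  mono-pentagonal : ∀ e → (mono e ⊗ pentagonal d (suc K)) N ≡ row 0 (+ N ℤ.- + e)
  mono-pentagonal e with e ℕ.≤? N
  ... | yes e≤N = begin
    (mono e ⊗ pentagonal d (suc K)) N              ≡⟨ cong (mono e ⊗ pentagonal d (suc K)) (ℕ.m+[n∸m]≡n e≤N) ⟨
    (mono e ⊗ pentagonal d (suc K)) (e ℕ.+ (N ℕ.∸ e)) ≡⟨ mono-⊗-+ e _ (N ℕ.∸ e) ⟩
    pentagonal d (suc K) (N ℕ.∸ e)                 ≡⟨ row-0 (N ℕ.∸ e) ⟨
    row 0 (+ (N ℕ.∸ e))                            ≡⟨ cong (row 0) (trans (ℤ.m-n≡m⊖n N e) (ℤ.⊖-≥ e≤N)) ⟨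
    row 0 (+ N ℤ.- + e)                            ∎
    where open ≡-Reasoning
  -- Here the target N - e is negative, while the form never is.
  ... | no  e≰N = trans (mono-⊗-< e _ N (ℕ.≰⇒> e≰N))
    (sym (∑ℤ-zero (suc K) (λ v → form-vanish d a 0 v (+ N ℤ.- + e) 1≤d
      (ℤ.<-≤-trans negative (ℤ.+≤+ (z≤n {formℕ a 0 v}))))))
    where
    negative : + 2 ℤ.* (+ N ℤ.- + e) ℤ.< + 0
    negative = subst (λ x → + 2 ℤ.* x ℤ.< + 0) (sym (ℤ.m-n≡m⊖n N e))
      (ℤ.*-monoˡ-<-pos (+ 2) (subst (N ℤ.⊖ e ℤ.<_) (ℤ.n⊖n≡0 N) (ℤ.⊖-monoʳ->-< N (ℕ.≰⇒> e≰N))))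

  pentagonal-⊗ : (pentagonal (c ℕ.* d) (suc K) ⊗ pentagonal d (suc K)) N ≡ ∑ (suc K ℕ.* 3) (λ j → row j (+ N))
  pentagonal-⊗ = begin
    (pentagonal (c ℕ.* d) (suc K) ⊗ θ) N
      ≡⟨ ∑ₛ-⊗ (suc K) _ θ N ⟩
    ∑ (suc K) (λ i → ((mono (e⁻ i) ⊕ mono (e⁺ i)) ⊗ θ) N)
      ≡⟨ ∑-cong (suc K) (λ i _ → three i) ⟩
    ∑ (suc K) (λ i → row (i ℕ.* 3) (+ N) ℙ.+ row (1 ℕ.+ i ℕ.* 3) (+ N) ℙ.+ row (2 ℕ.+ i ℕ.* 3) (+ N))
      ≡⟨ ∑-*3 (suc K) (λ j → row j (+ N)) ⟨
    ∑ (suc K ℕ.* 3) (λ j → row j (+ N)) ∎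
    where
    open ≡-Reasoning
    θ = pentagonal d (suc K)
    e⁻ e⁺ : ℕ → ℕ
    e⁻ i = c ℕ.* d ℕ.* pent⁻ i
    e⁺ i = c ℕ.* d ℕ.* pent⁺ i
    three : ∀ i → ((mono (e⁻ i) ⊕ mono (e⁺ i)) ⊗ θ) N
                ≡ row (i ℕ.* 3) (+ N) ℙ.+ row (1 ℕ.+ i ℕ.* 3) (+ N) ℙ.+ row (2 ℕ.+ i ℕ.* 3) (+ N)
    three i = begin
      ((mono (e⁻ i) ⊕ mono (e⁺ i)) ⊗ θ) N ≡⟨ ⊗-distribʳ θ (mono (e⁻ i)) (mono (e⁺ i)) N ⟩
      (mono (e⁻ i) ⊗ θ) N ℙ.+ (mono (e⁺ i) ⊗ θ) N ≡⟨ cong₂ ℙ._+_ (mono-pentagonal (e⁻ i)) (mono-pentagonal (e⁺ i)) ⟩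
      row 0 (+ N ℤ.- + e⁻ i) ℙ.+ row 0 (+ N ℤ.- + e⁺ i) ≡⟨ cong₂ ℙ._+_ (row-0-mod-3 i) (row-2-mod-3 i) ⟨
      row (i ℕ.* 3) (+ N) ℙ.+ row (2 ℕ.+ i ℕ.* 3) (+ N)
        -- The vanishing row 3i + 1 is inserted so that the sum runs over all rows.
        ≡⟨ cong (ℙ._+ row (2 ℕ.+ i ℕ.* 3) (+ N)) (trans (cong (row (i ℕ.* 3) (+ N) ℙ.+_) (row-1-mod-3 i (+ N) ℤ.≤-refl)) (ℙ.+-identityʳ (row (i ℕ.* 3) (+ N)))) ⟨
      row (i ℕ.* 3) (+ N) ℙ.+ row (1 ℕ.+ i ℕ.* 3) (+ N) ℙ.+ row (2 ℕ.+ i ℕ.* 3) (+ N) ∎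

  J : ℕ
  J = suc K ℕ.* 3

  column : ℤ → Parity
  column v = ∑ J (λ j → W j (+ N) v)

  J-large : ∀ j → J ℕ.≤ j → N ℕ.+ N ℕ.< j
  J-large j J≤j = begin-strict
    N ℕ.+ N         ≤⟨ ℕ.+-mono-≤ (ℕ.<⇒≤ N<K) (ℕ.<⇒≤ N<K) ⟩
    K ℕ.+ K         <⟨ s≤s (ℕ.m≤m+n (K ℕ.+ K) (K ℕ.+ 2)) ⟩
    suc (K ℕ.+ K ℕ.+ (K ℕ.+ 2)) ≡⟨ triple K ⟩
    suc K ℕ.* 3     ≤⟨ J≤j ⟩
    j               ∎
    where
    open ℕ.≤-Reasoning
    triple : ∀ K → suc (K ℕ.+ K ℕ.+ (K ℕ.+ 2)) ≡ suc K ℕ.* 3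
    triple = solve-ℕ

  W-large-j : ∀ v j → J ℕ.≤ j → W j (+ N) v ≡ 0ℙ
  W-large-j v j J≤j = form-vanish d a j v (+ N) 1≤d (2*-bound {+ N} ℤ.≤-refl (formℕ-large-j a j v N (J-large j J≤j)))

  rows-columns : ∑ J (λ j → row j (+ N)) ≡ column (+ 0) ℙ.+ ∑ K (λ i → column (+ suc i) ℙ.+ column -[1+ i ])
  rows-columns = begin
    ∑ J (λ j → row j (+ N)) ≡⟨ ∑-swap J (suc K) (λ j i → W j (+ N) (+ suc i) ℙ.+ W j (+ N) (ℤ.- + i)) ⟩
    ∑ (suc K) (λ i → ∑ J (λ j → W j (+ N) (+ suc i) ℙ.+ W j (+ N) (ℤ.- + i)))
      ≡⟨ ∑-cong (suc K) (λ i _ → ∑-+ J (λ j → W j (+ N) (+ suc i)) (λ j → W j (+ N) (ℤ.- + i))) ⟩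
    ∑ℤ (suc K) column ≡⟨ ∑ℤ-fold K column (∑-zero J (λ j _ → W-large-v j (+ N) (+ suc K) ℤ.≤-refl (ℕ.m≤n⇒m≤1+n N<K))) ⟩
    column (+ 0) ℙ.+ ∑ K (λ i → column (+ suc i) ℙ.+ column -[1+ i ]) ∎
    where open ≡-Reasoning

  column-pair : ∀ i p → + suc a ℤ.* + p ≡ + 2 ℤ.* + suc i
              → column (+ suc i) ℙ.+ column -[1+ i ] ≡ ∑ p (λ j → W j (+ N) (+ suc i))
  column-pair i p ap≡2v = begin
    column (+ suc i) ℙ.+ column -[1+ i ]
      -- Column -v is column v started at row p.
      ≡⟨ cong (column (+ suc i) ℙ.+_) (∑-cong J (λ j _ → cong (λ x → δ (+ d ℤ.* x ℤ.- + 2 ℤ.* + N))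
           (sym (form-neg (+ suc a) (+ p) (+ j) (+ suc i) ap≡2v)))) ⟩
    column (+ suc i) ℙ.+ ∑ J (λ j → W (p ℕ.+ j) (+ N) (+ suc i))
      ≡⟨ ∑-overlap J p (λ j → W j (+ N) (+ suc i)) (W-large-j (+ suc i)) ⟩
    ∑ p (λ j → W j (+ N) (+ suc i)) ∎
    where open ≡-Reasoning

  W-palindromic : ∀ v p → + suc a ℤ.* + p ≡ + 2 ℤ.* v → Palindromic p (λ j → W j (+ N) v)
  W-palindromic v p ap≡2v i j refl = cong (λ x → δ (+ d ℤ.* x ℤ.- + 2 ℤ.* + N)) (form-palindromic (+ suc a) (+ i) (+ j) v ap≡2v)

  column-0 : column (+ 0) ≡ ∑ J (λ j → mono (d ℕ.* (suc a ℕ.* tri j)) N)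
  column-0 = ∑-cong J λ j _ → W-value N j (+ 0) (suc a ℕ.* tri j) (begin
    form (+ suc a) (+ j) (+ 0)                ≡⟨ identity (+ suc a) (+ j) ⟩
    + suc a ℤ.* (+ j ℤ.* (+ 1 ℤ.+ + j))       ≡⟨ cong (+ suc a ℤ.*_) (+2*tri j) ⟨
    + suc a ℤ.* (+ 2 ℤ.* + tri j)             ≡⟨ exchange (+ suc a) (+ tri j) ⟩
    + 2 ℤ.* (+ suc a ℤ.* + tri j)             ≡⟨ cong (+ 2 ℤ.*_) (ℤ.pos-* (suc a) (tri j)) ⟨
    + 2 ℤ.* + (suc a ℕ.* tri j)               ∎)
    where
    open ≡-Reasoning
    identity : ∀ a j → a ℤ.* (j ℤ.* (j ℤ.+ + 1)) ℤ.- + 2 ℤ.* (j ℤ.* + 0) ℤ.+ + 0 ℤ.* (+ 3 ℤ.* + 0 ℤ.- + 1) ≡ a ℤ.* (j ℤ.* (+ 1 ℤ.+ j))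
    identity = solve-ℤ
    exchange : ∀ a T → a ℤ.* (+ 2 ℤ.* T) ≡ + 2 ℤ.* (a ℤ.* T)
    exchange = solve-ℤ

  pentagonal-⊗-columns : (pentagonal (c ℕ.* d) (suc K) ⊗ pentagonal d (suc K)) N
    ≡ ∑ J (λ j → mono (d ℕ.* (suc a ℕ.* tri j)) N) ℙ.+ ∑ K (λ i → column (+ suc i) ℙ.+ column -[1+ i ])
  pentagonal-⊗-columns = trans pentagonal-⊗ (trans rows-columns
    (cong (ℙ._+ ∑ K (λ i → column (+ suc i) ℙ.+ column -[1+ i ])) column-0))

-- The cases a = 1 and a = 2

+double : ∀ n → + double n ≡ + 2 ℤ.* + n
+double n = trans (cong +_ (double≡2* n)) (ℤ.pos-* 2 n)
  where
  double≡2* : ∀ n → double n ≡ 2 ℕ.* n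
  double≡2* zero    = refl
  double≡2* (suc n) = cong suc (trans (cong suc (double≡2* n)) (sym (ℕ.+-suc n (n ℕ.+ 0))))

-- For a = 1 the palindrome has length p = 2v, which is even, so only column 0 survives.
pentagonal-⊗-2 : ∀ d N K → 1 ℕ.≤ d → N ℕ.< K
  → (pentagonal (2 ℕ.* d) (suc K) ⊗ pentagonal d (suc K)) N ≡ ∑ (suc K ℕ.* 3) (λ j → mono (d ℕ.* (1 ℕ.* tri j)) N)
pentagonal-⊗-2 d N K 1≤d N<K = trans pentagonal-⊗-columns
  (trans (cong (∑ J (λ j → mono (d ℕ.* (1 ℕ.* tri j)) N) ℙ.+_) (∑-zero K λ i _ →
    trans (column-pair i (double (suc i)) (p≡2v i))
          (∑-palindromic-even (suc i) _ (W-palindromic (+ suc i) (double (suc i)) (p≡2v i)))))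
    (ℙ.+-identityʳ _))
  where
  open ThetaProduct d 0 1≤d N K N<K
  p≡2v : ∀ i → + 1 ℤ.* + double (suc i) ≡ + 2 ℤ.* + suc i
  p≡2v i = trans (ℤ.*-identityˡ (+ double (suc i))) (+double (suc i))

-- For a = 2 the length is p = v. The columns are grouped as v = 2r + 1 and v = 2r + 2, hence the
-- even window; the odd one leaves its midpoint j = r, where h(r, 2r + 1) = 1 + 5r(r + 1).
pentagonal-⊗-5 : ∀ d N L → 1 ℕ.≤ d → N ℕ.< double L
  → (pentagonal (5 ℕ.* d) (suc (double L)) ⊗ pentagonal d (suc (double L))) N
    ≡ ∑ (suc (double L) ℕ.* 3) (λ j → mono (d ℕ.* (2 ℕ.* tri j)) N) ℙ.+ ∑ L (λ r → mono (d ℕ.* (1 ℕ.+ 10 ℕ.* tri r)) N)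
pentagonal-⊗-5 d N L 1≤d N<K = trans pentagonal-⊗-columns
  (cong (∑ J (λ j → mono (d ℕ.* (2 ℕ.* tri j)) N) ℙ.+_)
    (trans (∑-double L _) (∑-cong L λ r _ → trans (cong₂ ℙ._+_ (odd-column r) (even-column r)) (ℙ.+-identityʳ _))))
  where
  open ThetaProduct d 1 1≤d N (double L) N<K
  odd-column : ∀ r → column (+ suc (double r)) ℙ.+ column -[1+ double r ] ≡ mono (d ℕ.* (1 ℕ.+ 10 ℕ.* tri r)) N
  odd-column r = trans (column-pair (double r) (suc (double r)) refl)
    (trans (∑-palindromic-odd r _ (W-palindromic (+ suc (double r)) (suc (double r)) refl))
           (W-value N r (+ suc (double r)) (1 ℕ.+ 10 ℕ.* tri r) centre))
    where
    open ≡-Reasoning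
    identity : ∀ r → + 2 ℤ.* (r ℤ.* (r ℤ.+ + 1)) ℤ.- + 2 ℤ.* (r ℤ.* (+ 1 ℤ.+ + 2 ℤ.* r)) ℤ.+ (+ 1 ℤ.+ + 2 ℤ.* r) ℤ.* (+ 3 ℤ.* (+ 1 ℤ.+ + 2 ℤ.* r) ℤ.- + 1)
      ≡ + 2 ℤ.* (+ 1 ℤ.+ + 5 ℤ.* (r ℤ.* (+ 1 ℤ.+ r)))
    identity = solve-ℤ
    ten : ∀ T → + 5 ℤ.* (+ 2 ℤ.* T) ≡ + 10 ℤ.* T
    ten = solve-ℤ
    centre : form (+ 2) (+ r) (+ suc (double r)) ≡ + 2 ℤ.* + (1 ℕ.+ 10 ℕ.* tri r)
    centre = begin
      form (+ 2) (+ r) (+ 1 ℤ.+ + double r)     ≡⟨ cong (λ x → form (+ 2) (+ r) (+ 1 ℤ.+ x)) (+double r) ⟩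
      form (+ 2) (+ r) (+ 1 ℤ.+ + 2 ℤ.* + r)    ≡⟨ identity (+ r) ⟩
      + 2 ℤ.* (+ 1 ℤ.+ + 5 ℤ.* (+ r ℤ.* (+ 1 ℤ.+ + r))) ≡⟨ cong (λ x → + 2 ℤ.* (+ 1 ℤ.+ + 5 ℤ.* x)) (+2*tri r) ⟨
      + 2 ℤ.* (+ 1 ℤ.+ + 5 ℤ.* (+ 2 ℤ.* + tri r)) ≡⟨ cong (λ x → + 2 ℤ.* (+ 1 ℤ.+ x)) (trans (ten (+ tri r)) (sym (ℤ.pos-* 10 (tri r)))) ⟩
      + 2 ℤ.* + (1 ℕ.+ 10 ℕ.* tri r) ∎
  even-column : ∀ r → column (+ suc (suc (double r))) ℙ.+ column -[1+ suc (double r) ] ≡ 0ℙ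
  even-column r = trans (column-pair (suc (double r)) (double (suc r)) refl)
    (∑-palindromic-even (suc r) _ (W-palindromic (+ double (suc r)) (double (suc r)) refl))

-- Theta series as infinite sums, and their dissection

monos : (ℕ → ℕ) → Series₂
monos f n = ∑ (suc n) (λ j → mono (f j) n)

-- Indices j > n have exponents above n, so the cut at j ≤ n in `monos` loses nothing and any longer
-- finite sum gives the same coefficient.
∑-mono-extend : ∀ f → (∀ j → j ℕ.≤ f j) → ∀ K n → n ℕ.< K → ∑ K (λ j → mono (f j) n) ≡ monos f n
∑-mono-extend f f-large K n n<K = begin
  ∑ K t                     ≡⟨ cong (λ k → ∑ k t) (ℕ.m+[n∸m]≡n n<K) ⟨
  ∑ (suc n ℕ.+ r) t         ≡⟨ ∑-split (suc n) r t ⟩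
  monos f n ℙ.+ ∑ r (λ i → t (suc n ℕ.+ i))
    ≡⟨ cong (monos f n ℙ.+_) (∑-zero r (λ i _ → mono≈0 (ℕ.<-≤-trans (s≤s (ℕ.m≤m+n n i)) (f-large (suc n ℕ.+ i))) n ℕ.≤-refl)) ⟩
  monos f n ℙ.+ 0ℙ          ≡⟨ ℙ.+-identityʳ _ ⟩
  monos f n ∎
  where
  open ≡-Reasoning
  r = K ℕ.∸ suc n
  t = λ j → mono (f j) n

n≤tri : ∀ n → n ℕ.≤ tri n
n≤tri zero    = z≤n
n≤tri (suc n) = ℕ.m≤n+m (suc n) (tri n)

n≤c*tri : ∀ c → 1 ℕ.≤ c → ∀ n → n ℕ.≤ c ℕ.* tri n
n≤c*tri (suc c) _ n = ℕ.≤-trans (n≤tri n) (ℕ.m≤m+n (tri n) _)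

gaussian : ℕ → Series₂
gaussian d = monos (λ j → d ℕ.* tri j)

-- The series U, with j(j + 1) = 2 tri j and 5r(r + 1) = 10 tri r.
oblongs : Series₂
oblongs = monos (λ j → 2 ℕ.* tri j) ⊕ monos (λ r → 1 ℕ.+ 10 ℕ.* tri r)

mono-double : ∀ e n → mono (double e) (double n) ≡ mono e n
mono-double zero    zero    = refl
mono-double zero    (suc n) = refl
mono-double (suc e) zero    = refl
mono-double (suc e) (suc n) = mono-double e n

mono-odd-even : ∀ e n → mono (suc (double e)) (double n) ≡ 0ℙ
mono-odd-even e       zero    = refl
mono-odd-even zero    (suc n) = refl
mono-odd-even (suc e) (suc n) = mono-odd-even e n

mono-even-odd : ∀ e n → mono (double e) (suc (double n)) ≡ 0ℙ
mono-even-odd zero    n       = refl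
mono-even-odd (suc e) zero    = refl
mono-even-odd (suc e) (suc n) = mono-even-odd e n

double≡2* : ∀ n → double n ≡ 2 ℕ.* n
double≡2* n = ℤ.+-injective (trans (+double n) (sym (ℤ.pos-* 2 n)))

n<double : ∀ n → n ℕ.< suc (double n)
n<double zero    = s≤s z≤n
n<double (suc n) = s≤s (ℕ.m≤n⇒m≤1+n (n<double n))

10*tri : ∀ r → 10 ℕ.* tri r ≡ double (5 ℕ.* tri r)
10*tri r = trans (ℕ.*-assoc 2 5 (tri r)) (sym (double≡2* (5 ℕ.* tri r)))

even-oblongs : ∀ n → even oblongs n ≡ gaussian 1 n
even-oblongs n = begin
  even oblongs n
    ≡⟨ cong₂ ℙ._+_
         (∑-cong (suc (double n)) (λ j _ → trans (cong (λ e → mono e (double n)) (trans (sym (double≡2* (tri j))) (cong double (sym (ℕ.*-identityˡ (tri j))))))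
           (mono-double (1 ℕ.* tri j) n)))
         (∑-zero (suc (double n)) (λ r _ → trans (cong (λ e → mono (suc e) (double n)) (10*tri r)) (mono-odd-even (5 ℕ.* tri r) n))) ⟩
  ∑ (suc (double n)) (λ j → mono (1 ℕ.* tri j) n) ℙ.+ 0ℙ ≡⟨ ℙ.+-identityʳ _ ⟩
  ∑ (suc (double n)) (λ j → mono (1 ℕ.* tri j) n) ≡⟨ ∑-mono-extend _ (n≤c*tri 1 ℕ.≤-refl) (suc (double n)) n (n<double n) ⟩
  gaussian 1 n ∎
  where open ≡-Reasoning

odd-oblongs : ∀ n → odd oblongs n ≡ gaussian 5 n
odd-oblongs n = begin
  odd oblongs n
    ≡⟨ cong₂ ℙ._+_
         (∑-zero (suc (suc (double n))) (λ j _ → trans (cong (λ e → mono e (suc (double n))) (sym (double≡2* (tri j)))) (mono-even-odd (tri j) n)))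
         (∑-cong (suc (suc (double n))) (λ r _ → trans (cong (λ e → mono e (double n)) (10*tri r)) (mono-double (5 ℕ.* tri r) n))) ⟩
  ∑ (suc (suc (double n))) (λ r → mono (5 ℕ.* tri r) n)
    ≡⟨ ∑-mono-extend _ (n≤c*tri 5 (s≤s z≤n)) (suc (suc (double n))) n (ℕ.m≤n⇒m≤1+n (n<double n)) ⟩
  gaussian 5 n ∎
  where open ≡-Reasoning

-- Euler products as theta series

≈-restrict : ∀ {m n f g} → n ℕ.≤ m → f ≈[ m ] g → f ≈[ n ] g
≈-restrict n≤m p k k≤n = p k (ℕ.≤-trans k≤n n≤m)

product≈pentagonal-wide : ∀ d m K → 1 ℕ.≤ d → m ℕ.< K → product d m ≈[ m ] pentagonal d K
product≈pentagonal-wide d m K 1≤d m<K k k≤m =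
  trans (product≈pentagonal d m 1≤d (K ℕ.∸ suc m) k k≤m)
        (cong (λ K → pentagonal d K k) (trans (sym (ℕ.+-suc (K ℕ.∸ suc m) m)) (ℕ.m∸n+n≡m m<K)))

product-suc-0 : ∀ d n → 1 ℕ.≤ d → product d n 0 ≡ 1ℙ
product-suc-0 d       zero    _ = refl
product-suc-0 (suc d) (suc n) p = product-suc-0 (suc d) n p

module _ (m : ℕ) where
  open Modulo m
  open import Relation.Binary.Reasoning.Setoid setoid

  1+mono-square : ∀ e → (1ₛ ⊕ mono e) ⊗ (1ₛ ⊕ mono e) ≈ 1ₛ ⊕ mono (2 ℕ.* e)
  1+mono-square e = begin
    (1ₛ ⊕ mono e) ⊗ (1ₛ ⊕ mono e) ≈⟨ solve 1 (λ x → (con 1 :+ x) :* (con 1 :+ x) := con 1 :+ x :* x) ≈-refl (mono e) ⟩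
    1ₛ ⊕ mono e ⊗ mono e          ≈⟨ ⊕-congˡ {1ₛ} (λ n _ → trans (mono-+ e e n) (cong (λ k → mono (e ℕ.+ k) n) (sym (ℕ.+-identityʳ e)))) ⟩
    1ₛ ⊕ mono (2 ℕ.* e)           ∎

  product-double : ∀ d n → product (2 ℕ.* d) n ≈ product d n ⊗ product d n
  product-double d zero    = ≈-sym (*-identityˡ 1ₛ)
  product-double d (suc n) = begin
    (1ₛ ⊕ mono (2 ℕ.* d ℕ.* suc n)) ⊗ product (2 ℕ.* d) n
      ≈⟨ ⊗-cong (≈-sym (≈-trans (1+mono-square (d ℕ.* suc n)) (λ k _ → cong (λ e → (1ₛ ⊕ mono e) k) (sym (ℕ.*-assoc 2 d (suc n)))))) (product-double d n) ⟩
    (o ⊗ o) ⊗ (product d n ⊗ product d n)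
      ≈⟨ solve 2 (λ o p → (o :* o) :* (p :* p) := (o :* p) :* (o :* p)) ≈-refl o (product d n) ⟩
    product d (suc n) ⊗ product d (suc n) ∎
    where o = 1ₛ ⊕ mono (d ℕ.* suc n)

  -- By Frobenius f_d³ = f_d f_{2d}, which is the case a = 1.
  product-cube : ∀ d → 1 ℕ.≤ d → product d m ⊗ (product d m ⊗ product d m) ≈ gaussian d
  product-cube d 1≤d = begin
    product d m ⊗ (product d m ⊗ product d m) ≈⟨ ⊗-congˡ {product d m} (product-double d m) ⟨
    product d m ⊗ product (2 ℕ.* d) m         ≈⟨ *-comm (product d m) (product (2 ℕ.* d) m) ⟩
    product (2 ℕ.* d) m ⊗ product d m
      ≈⟨ ⊗-cong (product≈pentagonal-wide (2 ℕ.* d) m (suc K) (ℕ.≤-trans 1≤d (ℕ.m≤m+n d _)) m<K) (product≈pentagonal-wide d m (suc K) 1≤d m<K) ⟩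
    pentagonal (2 ℕ.* d) (suc K) ⊗ pentagonal d (suc K)
      ≈⟨ (λ n n≤m → trans (pentagonal-⊗-2 d n K 1≤d (s≤s n≤m))
            (trans (∑-cong (suc K ℕ.* 3) (λ j _ → cong (λ T → mono (d ℕ.* T) n) (ℕ.*-identityˡ (tri j))))
                   (∑-mono-extend _ (n≤c*tri d 1≤d) (suc K ℕ.* 3) n
                     (ℕ.<-≤-trans (s≤s n≤m) (ℕ.≤-trans (ℕ.n≤1+n K) (ℕ.m≤m*n (suc K) 3)))))) ⟩
    gaussian d ∎
    where
    K = suc m
    m<K : m ℕ.< suc K
    m<K = ℕ.m≤n⇒m≤1+n ℕ.≤-refl

  product-1-5 : product 1 m ⊗ product 5 m ≈ oblongs
  product-1-5 = begin
    product 1 m ⊗ product 5 m ≈⟨ *-comm (product 1 m) (product 5 m) ⟩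
    product 5 m ⊗ product 1 m
      ≈⟨ ⊗-cong (product≈pentagonal-wide 5 m (suc K) (s≤s z≤n) m<K) (product≈pentagonal-wide 1 m (suc K) ℕ.≤-refl m<K) ⟩
    pentagonal 5 (suc K) ⊗ pentagonal 1 (suc K)
      ≈⟨ (λ n n≤m → trans (pentagonal-⊗-5 1 n L ℕ.≤-refl (n<K n n≤m))
           (cong₂ ℙ._+_
             (trans (∑-cong (suc K ℕ.* 3) (λ j _ → cong (λ e → mono e n) (ℕ.*-identityˡ (2 ℕ.* tri j))))
                    (∑-mono-extend _ (n≤c*tri 2 (s≤s z≤n)) (suc K ℕ.* 3) n
                      (ℕ.<-≤-trans (n<K n n≤m) (ℕ.≤-trans (ℕ.n≤1+n K) (ℕ.m≤m*n (suc K) 3)))))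
             (trans (∑-cong L (λ r _ → cong (λ e → mono e n) (ℕ.*-identityˡ (1 ℕ.+ 10 ℕ.* tri r))))
                    (∑-mono-extend _ (λ r → ℕ.m≤n⇒m≤1+n (n≤c*tri 10 (s≤s z≤n) r)) L n (s≤s n≤m))))) ⟩
    oblongs ∎
    where
    -- L bounds the sum over r and has to exceed m itself; K = 2L then does so too.
    L = suc m
    K = double L
    n<K : ∀ n → n ℕ.≤ m → n ℕ.< K
    n<K n n≤m = ℕ.≤-<-trans n≤m (ℕ.m≤n⇒m≤1+n (n<double m))
    m<K : m ℕ.< suc K
    m<K = ℕ.m≤n⇒m≤1+n (n<K m ℕ.≤-refl)

-- Reduction of the eta quotient modulo 2

parityℤ : ℤ → Parity
parityℤ i = parity ∣ i ∣

parity-⊖ : ∀ m n → parityℤ (m ℤ.⊖ n) ≡ parity m ℙ.+ parity n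
parity-⊖ zero    zero    = refl
parity-⊖ zero    (suc n) = refl
parity-⊖ (suc m) zero    = sym (ℙ.+-identityʳ (parity (suc m)))
parity-⊖ (suc m) (suc n) = begin
  parityℤ (suc m ℤ.⊖ suc n)           ≡⟨ cong parityℤ (ℤ.[1+m]⊖[1+n]≡m⊖n m n) ⟩
  parityℤ (m ℤ.⊖ n)                   ≡⟨ parity-⊖ m n ⟩
  parity m ℙ.+ parity n               ≡⟨ cancel-suc (parity (suc m)) (parity (suc n)) (ℙ.suc-homo-⁻¹ m) (ℙ.suc-homo-⁻¹ n) ⟨
  parity (suc m) ℙ.+ parity (suc n)   ∎
  where
  open ≡-Reasoning
  cancel-suc : ∀ p q {p′ q′} → p ℙ.⁻¹ ≡ p′ → q ℙ.⁻¹ ≡ q′ → p ℙ.+ q ≡ p′ ℙ.+ q′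
  cancel-suc 0ℙ 0ℙ refl refl = refl
  cancel-suc 0ℙ 1ℙ refl refl = refl
  cancel-suc 1ℙ 0ℙ refl refl = refl
  cancel-suc 1ℙ 1ℙ refl refl = refl

parityℤ-+ : ∀ i j → parityℤ (i ℤ.+ j) ≡ parityℤ i ℙ.+ parityℤ j
parityℤ-+ (+ m)    (+ n)    = ℙ.+-homo-+ m n
parityℤ-+ (+ m)    -[1+ n ] = parity-⊖ m (suc n)
parityℤ-+ -[1+ m ] (+ n)    = trans (parity-⊖ n (suc m)) (ℙ.+-comm (parity n) (parity (suc m)))
parityℤ-+ -[1+ m ] -[1+ n ] = trans (cong (λ k → parity (suc k)) (sym (ℕ.+-suc m n))) (ℙ.+-homo-+ (suc m) (suc n))

parityℤ-* : ∀ i j → parityℤ (i ℤ.* j) ≡ parityℤ i ℙ.* parityℤ j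
parityℤ-* i j = trans (cong parity (ℤ.abs-* i j)) (ℙ.*-homo-* ∣ i ∣ ∣ j ∣)

parity-even : ∀ n → parity n ≡ 0ℙ → 2 ∣ n
parity-even zero          _ = 2 ℕD.∣0
parity-even (suc (suc n)) p = ℕD.∣m∣n⇒∣m+n (ℕD.∣-refl {2}) (parity-even n p)

reduce : Series → Series₂
reduce f n = parityℤ (f n)

sumTo-head : ∀ n f → sumTo (suc n) f ≡ f 0 ℤ.+ sumTo n (f ∘ suc)
sumTo-head zero    f = refl
sumTo-head (suc n) f = trans (cong (ℤ._+ f (suc (suc n))) (sumTo-head n f)) (ℤ.+-assoc (f 0) (sumTo n (f ∘ suc)) (f (suc (suc n))))

reduce-⊛ : ∀ f g n → reduce (f ⊛ g) n ≡ (reduce f ⊗ reduce g) n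
reduce-⊛ f g zero    = parityℤ-* (f 0) (g 0)
reduce-⊛ f g (suc n) = begin
  parityℤ ((f ⊛ g) (suc n)) ≡⟨ cong parityℤ (sumTo-head n (λ i → f i ℤ.* g (suc n ℕ.∸ i))) ⟩
  parityℤ (f 0 ℤ.* g (suc n) ℤ.+ ((f ∘ suc) ⊛ g) n) ≡⟨ parityℤ-+ (f 0 ℤ.* g (suc n)) _ ⟩
  parityℤ (f 0 ℤ.* g (suc n)) ℙ.+ reduce ((f ∘ suc) ⊛ g) n ≡⟨ cong₂ ℙ._+_ (parityℤ-* (f 0) (g (suc n))) (reduce-⊛ (f ∘ suc) g n) ⟩
  (reduce f ⊗ reduce g) (suc n) ∎
  where open ≡-Reasoning

reduce-one : ∀ n → reduce one n ≡ 1ₛ n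
reduce-one zero    = refl
reduce-one (suc n) = refl

reduce-oneMinus : ∀ d n → reduce (oneMinus (suc d)) n ≡ (1ₛ ⊕ mono (suc d)) n
reduce-oneMinus d zero    = refl
reduce-oneMinus d (suc n) = delta d n
  where
  delta : ∀ d n → parityℤ (if does (n ℕ.≟ d) then ℤ.- (+ 1) else + 0) ≡ mono d n
  delta zero    zero    = refl
  delta zero    (suc n) = refl
  delta (suc d) zero    = refl
  delta (suc d) (suc n) = delta d n

geom-+ : ∀ d n → geom d (d ℕ.+ n) ≡ geom d n
geom-+ d n = cong (λ b → if b then + 1 else + 0) (does-⇔
  (mk⇔ (λ d∣d+n → ℕD.∣m+n∣m⇒∣n d∣d+n ℕD.∣-refl) (ℕD.∣m∣n⇒∣m+n ℕD.∣-refl)) (d ∣? d ℕ.+ n) (d ∣? n))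

geom-< : ∀ d n → n ℕ.< suc d → reduce (geom (suc d)) n ≡ 1ₛ n
geom-< d zero    _   = cong (λ b → parityℤ (if b then + 1 else + 0)) (dec-true (suc d ∣? 0) (suc d ℕD.∣0))
geom-< d (suc n) n<d = cong (λ b → parityℤ (if b then + 1 else + 0)) (dec-false (suc d ∣? suc n) (ℕD.>⇒∤ n<d))

-- From degree `suc d` on, the coefficients at n and at n - `suc d` agree by periodicity and cancel
-- modulo 2; below that degree only the constant term is left.
geom-inverse : ∀ d n → ((1ₛ ⊕ mono (suc d)) ⊗ reduce (geom (suc d))) n ≡ 1ₛ n
geom-inverse d n = trans (⊗-distribʳ g 1ₛ (mono (suc d)) n) (trans (cong (ℙ._+ (mono (suc d) ⊗ g) n) (⊗-identityˡ g n)) cases)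
  where
  g = reduce (geom (suc d))
  cases : g n ℙ.+ (mono (suc d) ⊗ g) n ≡ 1ₛ n
  cases with suc d ℕ.≤? n
  ... | no  d≰n = trans (cong (g n ℙ.+_) (mono-⊗-< (suc d) g n (ℕ.≰⇒> d≰n)))
                        (trans (ℙ.+-identityʳ (g n)) (geom-< d n (ℕ.≰⇒> d≰n)))
  ... | yes d≤n = subst (λ k → g k ℙ.+ (mono (suc d) ⊗ g) k ≡ 1ₛ k) (ℕ.m+[n∸m]≡n d≤n)
    (trans (cong (g (suc d ℕ.+ r) ℙ.+_) (trans (mono-⊗-+ (suc d) g r) (sym (cong parityℤ (geom-+ (suc d) r)))))
           (ℙ.p+p≡0ℙ (g (suc d ℕ.+ r))))
    where r = n ℕ.∸ suc d

power : Series₂ → ℕ → Series₂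
power f zero    = 1ₛ
power f (suc k) = f ⊗ power f k

fifth : Series₂ → Series₂
fifth f = power f 5

module _ (m : ℕ) where
  open Modulo m
  open import Relation.Binary.Reasoning.Setoid setoid

  fifth-cong : ∀ {f g} → f ≈ g → fifth f ≈ fifth g
  fifth-cong p = ⊗-cong p (⊗-cong p (⊗-cong p (⊗-cong p (⊗-cong p ≈-refl))))

  reduce-⊛-cong : ∀ f g {f′ g′} → reduce f ≈ f′ → reduce g ≈ g′ → reduce (f ⊛ g) ≈ f′ ⊗ g′
  reduce-⊛-cong f g p q = ≈-trans (λ n _ → reduce-⊛ f g n) (⊗-cong p q)

  reduce-pow : ∀ f k → reduce (pow f k) ≈ power (reduce f) k
  reduce-pow f zero    n _ = reduce-one n
  reduce-pow f (suc k)     = reduce-⊛-cong f (pow f k) ≈-refl (reduce-pow f k)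

  -- By Frobenius, f₂ = f₁² and f₁₀ = f₅², so the factor is (1 - q^n)/(1 - q^5n)⁵ modulo 2.
  reduce-factor : ∀ n → reduce (factor (suc n)) ⊗ fifth (1ₛ ⊕ mono (5 ℕ.* suc n)) ≈ 1ₛ ⊕ mono (1 ℕ.* suc n)
  reduce-factor n = begin
    reduce (factor k) ⊗ fifth o₅ ≈⟨ ⊗-congʳ {fifth o₅} expand ⟩
    ((o₁ ⊗ o₁) ⊗ (fifth o₅ ⊗ (g₁ ⊗ fifth g₁₀))) ⊗ fifth o₅ ≈⟨ regroup ⟩
    o₁ ⊗ ((o₁ ⊗ g₁) ⊗ fifth ((o₅ ⊗ o₅) ⊗ g₁₀)) ≈⟨ ⊗-congˡ {o₁} (⊗-cong inverse₁ (fifth-cong inverse₁₀)) ⟩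
    o₁ ⊗ (1ₛ ⊗ fifth 1ₛ) ≈⟨ solve 1 (λ o → o :* (con 1 :* (con 1 :* (con 1 :* (con 1 :* (con 1 :* (con 1 :* con 1)))))) := o) ≈-refl o₁ ⟩
    o₁ ∎
    where
    k = suc n
    o₁ = 1ₛ ⊕ mono (1 ℕ.* k)
    o₅ = 1ₛ ⊕ mono (5 ℕ.* k)
    g₁ = reduce (geom k)
    g₁₀ = reduce (geom (10 ℕ.* k))
    expand : reduce (factor k) ≈ (o₁ ⊗ o₁) ⊗ (fifth o₅ ⊗ (g₁ ⊗ fifth g₁₀))
    expand = reduce-⊛-cong (oneMinus (2 ℕ.* k)) (pow (oneMinus (5 ℕ.* k)) 5 ⊛ (geom k ⊛ pow (geom (10 ℕ.* k)) 5))
      (≈-trans (λ i _ → reduce-oneMinus _ i) (≈-sym (≈-trans (1+mono-square m (1 ℕ.* k)) (λ i _ → cong (λ e → (1ₛ ⊕ mono (2 ℕ.* e)) i) (ℕ.*-identityˡ k)))))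
      (reduce-⊛-cong (pow (oneMinus (5 ℕ.* k)) 5) (geom k ⊛ pow (geom (10 ℕ.* k)) 5)
        (≈-trans (reduce-pow (oneMinus (5 ℕ.* k)) 5) (fifth-cong (λ i _ → reduce-oneMinus _ i)))
        (reduce-⊛-cong (geom k) (pow (geom (10 ℕ.* k)) 5) ≈-refl (reduce-pow (geom (10 ℕ.* k)) 5)))
    regroup : ((o₁ ⊗ o₁) ⊗ (fifth o₅ ⊗ (g₁ ⊗ fifth g₁₀))) ⊗ fifth o₅ ≈ o₁ ⊗ ((o₁ ⊗ g₁) ⊗ fifth ((o₅ ⊗ o₅) ⊗ g₁₀))
    regroup = solve 4 (λ o p g h → let f = λ x → x :* (x :* (x :* (x :* (x :* con 1)))) in
      ((o :* o) :* (f p :* (g :* f h))) :* f p := o :* ((o :* g) :* f ((p :* p) :* h))) ≈-refl o₁ o₅ g₁ g₁₀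
    inverse₁ : o₁ ⊗ g₁ ≈ 1ₛ
    inverse₁ i _ = trans (cong (λ e → ((1ₛ ⊕ mono e) ⊗ g₁) i) (ℕ.*-identityˡ k)) (geom-inverse n i)
    inverse₁₀ : (o₅ ⊗ o₅) ⊗ g₁₀ ≈ 1ₛ
    inverse₁₀ = ≈-trans (⊗-congʳ {g₁₀} (≈-trans (1+mono-square m (5 ℕ.* k)) (λ i _ → cong (λ e → (1ₛ ⊕ mono e) i) (sym (ℕ.*-assoc 2 5 k)))))
      (λ i _ → geom-inverse _ i)

  -- Holds between the finite products already, factor by factor, with n independent of the degree
  -- m.
  reduce-partialProd : ∀ n → reduce (partialProd n) ⊗ fifth (product 5 n) ≈ product 1 n
  reduce-partialProd zero    = ≈-trans (⊗-congʳ {fifth 1ₛ} (λ n _ → reduce-one n))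
    (solve 0 (con 1 :* (con 1 :* (con 1 :* (con 1 :* (con 1 :* (con 1 :* con 1))))) := con 1) ≈-refl)
  reduce-partialProd (suc n) = begin
    reduce (partialProd (suc n)) ⊗ fifth (o ⊗ product 5 n) ≈⟨ ⊗-congʳ {fifth (o ⊗ product 5 n)} (λ i _ → reduce-⊛ (factor (suc n)) (partialProd n) i) ⟩
    (F ⊗ G) ⊗ fifth (o ⊗ product 5 n)
      ≈⟨ solve 4 (λ F G o p → let f = λ x → x :* (x :* (x :* (x :* (x :* con 1)))) in
           (F :* G) :* f (o :* p) := (F :* f o) :* (G :* f p)) ≈-refl F G o (product 5 n) ⟩
    (F ⊗ fifth o) ⊗ (G ⊗ fifth (product 5 n)) ≈⟨ ⊗-cong (reduce-factor n) (reduce-partialProd n) ⟩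
    product 1 (suc n) ∎
    where
    F = reduce (factor (suc n))
    G = reduce (partialProd n)
    o = 1ₛ ⊕ mono (5 ℕ.* suc n)

-- Dissection of F

double-mono-≤ : ∀ {m n} → m ℕ.≤ n → double m ℕ.≤ double n
double-mono-≤ z≤n     = z≤n
double-mono-≤ (s≤s p) = s≤s (s≤s (double-mono-≤ p))

even-cong : ∀ {n f g} → f ≈[ double n ] g → even f ≈[ n ] even g
even-cong p k k≤n = p (double k) (double-mono-≤ k≤n)

odd-cong : ∀ {n f g} → f ≈[ suc (double n) ] g → odd f ≈[ n ] odd g
odd-cong p k k≤n = p (suc (double k)) (s≤s (double-mono-≤ k≤n))

-- The degree 4n + 2 = 2(2n + 1) prescribes an even part, then an odd part. Precision halves along
-- the way: `whole` holds up to m = 4n + 2, `half` up to l = 2n + 1 and `quarter` up to n.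
reduce-partialProd-quarter : ∀ n → reduce (partialProd (double (suc (double n)))) (double (suc (double n))) ≡ oblongs n
reduce-partialProd-quarter n =
  trans (⊗-cancelˡ (p₅ ⊗ p₅) {odd (even G)} {p₁ ⊗ p₅} p₅²-0 quarter n ℕ.≤-refl) (product-1-5 m n n≤m)
  where
  l = suc (double n)
  m = double l
  n≤l : n ℕ.≤ l
  n≤l = ℕ.<⇒≤ (n<double n)
  l≤m : l ℕ.≤ m
  l≤m = ℕ.≤-pred (n<double l)
  n≤m : n ℕ.≤ m
  n≤m = ℕ.≤-trans n≤l l≤m
  G = reduce (partialProd m)
  p₁ = product 1 m
  p₅ = product 5 m
  p₅³ = p₅ ⊗ (p₅ ⊗ p₅)
  p₅²-0 : (p₅ ⊗ p₅) 0 ≡ 1ℙ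
  p₅²-0 rewrite product-suc-0 5 m (s≤s z≤n) = refl

  -- One more factor f₅ completes f₅⁵ to the square of f₅³ and turns f₁ into U.
  whole : (p₅³ ⊗ p₅³) ⊗ G ≈[ m ] oblongs
  whole = begin
    (p₅³ ⊗ p₅³) ⊗ G ≈⟨ solve 2 (λ p G → ((p :* (p :* p)) :* (p :* (p :* p))) :* G
                             := p :* (G :* (p :* (p :* (p :* (p :* (p :* con 1))))))) ≈-refl p₅ G ⟩
    p₅ ⊗ (G ⊗ fifth p₅) ≈⟨ ⊗-congˡ {p₅} (reduce-partialProd m m) ⟩
    p₅ ⊗ p₁ ≈⟨ *-comm p₅ p₁ ⟩
    p₁ ⊗ p₅ ≈⟨ product-1-5 m ⟩
    oblongs ∎
    where
    open Modulo m
    open import Relation.Binary.Reasoning.Setoid setoid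

  -- The dissection gives f₅³ · even G = f₁³. A further factor f₅ makes this f₅⁴ · even G = f₁² U,
  -- again a square times a series on both sides, ready for the second dissection.
  half : (p₅ ⊗ p₅) ⊗ ((p₅ ⊗ p₅) ⊗ even G) ≈[ l ] (p₁ ⊗ p₁) ⊗ oblongs
  half = begin
    (p₅ ⊗ p₅) ⊗ ((p₅ ⊗ p₅) ⊗ even G) ≈⟨ solve 2 (λ p G → (p :* p) :* ((p :* p) :* G) := p :* ((p :* (p :* p)) :* G)) ≈-refl p₅ (even G) ⟩
    p₅ ⊗ (p₅³ ⊗ even G) ≈⟨ ⊗-congˡ {p₅} (λ k k≤l → trans (sym (even-square-⊗ p₅³ G k))
        (trans (even-cong {l} whole k k≤l) (even-oblongs k))) ⟩
    p₅ ⊗ gaussian 1 ≈⟨ ⊗-congˡ {p₅} (≈-restrict l≤m (product-cube m 1 ℕ.≤-refl)) ⟨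
    p₅ ⊗ (p₁ ⊗ (p₁ ⊗ p₁)) ≈⟨ solve 2 (λ p r → p :* (r :* (r :* r)) := (r :* r) :* (r :* p)) ≈-refl p₅ p₁ ⟩
    (p₁ ⊗ p₁) ⊗ (p₁ ⊗ p₅) ≈⟨ ⊗-congˡ {p₁ ⊗ p₁} (≈-restrict l≤m (product-1-5 m)) ⟩
    (p₁ ⊗ p₁) ⊗ oblongs ∎
    where
    open Modulo l
    open import Relation.Binary.Reasoning.Setoid setoid

  quarter : (p₅ ⊗ p₅) ⊗ odd (even G) ≈[ n ] (p₅ ⊗ p₅) ⊗ (p₁ ⊗ p₅)
  quarter = begin
    (p₅ ⊗ p₅) ⊗ odd (even G) ≈⟨ ⊗-assoc₄ ⟩
    p₅ ⊗ (p₅ ⊗ odd (even G))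
      ≈⟨ ⊗-congˡ {p₅} (λ k _ → odd-square-⊗ p₅ (even G) k) ⟨
    p₅ ⊗ odd ((p₅ ⊗ p₅) ⊗ even G) ≈⟨ (λ k _ → odd-square-⊗ p₅ ((p₅ ⊗ p₅) ⊗ even G) k) ⟨
    odd ((p₅ ⊗ p₅) ⊗ ((p₅ ⊗ p₅) ⊗ even G)) ≈⟨ odd-cong {n} half ⟩
    odd ((p₁ ⊗ p₁) ⊗ oblongs) ≈⟨ (λ k _ → odd-square-⊗ p₁ oblongs k) ⟩
    p₁ ⊗ odd oblongs ≈⟨ ⊗-congˡ {p₁} (λ k _ → odd-oblongs k) ⟩
    p₁ ⊗ gaussian 5 ≈⟨ ⊗-congˡ {p₁} (≈-restrict n≤m (product-cube m 5 (s≤s z≤n))) ⟨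
    p₁ ⊗ p₅³ ≈⟨ solve 2 (λ r p → r :* (p :* (p :* p)) := (p :* p) :* (r :* p)) ≈-refl p₁ p₅ ⟩
    (p₅ ⊗ p₅) ⊗ (p₁ ⊗ p₅) ∎
    where
    open Modulo n
    open import Relation.Binary.Reasoning.Setoid setoid
    ⊗-assoc₄ : (p₅ ⊗ p₅) ⊗ odd (even G) ≈ p₅ ⊗ (p₅ ⊗ odd (even G))
    ⊗-assoc₄ k _ = ⊗-assoc p₅ p₅ (odd (even G)) k

J10-parity : ∀ n → parityℤ (J10 (4 ℕ.* n ℕ.+ 1)) ≡ oblongs n
J10-parity n = trans (cong (λ m → parityℤ (partialProd m m)) index) (reduce-partialProd-quarter n)
  where
  index : suc (4 ℕ.* n ℕ.+ 1) ≡ double (suc (double n))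
  index = trans (identity n) (sym (trans (double≡2* (suc (double n))) (cong (λ k → 2 ℕ.* suc k) (double≡2* n))))
    where
    identity : ∀ n → suc (4 ℕ.* n ℕ.+ 1) ≡ 2 ℕ.* suc (2 ℕ.* n)
    identity = solve-ℕ

-- Counting

∑≡1 : ∀ K f → ∑ K f ≡ 1ℙ → ∃[ i ] (i ℕ.< K × f i ≡ 1ℙ)
∑≡1 (suc K) f p with f K in fK
... | 1ℙ = K , ℕ.≤-refl , fK
... | 0ℙ with ∑≡1 K f (trans (sym (ℙ.+-identityʳ (∑ K f))) p)
...   | i , i<K , fi = i , ℕ.m≤n⇒m≤1+n i<K , fi

mono≡1 : ∀ d n → mono d n ≡ 1ℙ → d ≡ n
mono≡1 zero    zero    _ = refl
mono≡1 (suc d) (suc n) p = cong suc (mono≡1 d n p)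

oblong₁ oblong₅ : ℕ → ℕ
oblong₁ j = 2 ℕ.* tri j
oblong₅ r = 1 ℕ.+ 10 ℕ.* tri r

square≤oblong₁ : ∀ j → j ℕ.* j ℕ.≤ oblong₁ j
square≤oblong₁ j = ℕ.≤-trans (ℕ.*-monoʳ-≤ j (ℕ.n≤1+n j)) (ℕ.≤-reflexive (sym (2*tri j)))

square≤oblong₅ : ∀ r → r ℕ.* r ℕ.≤ oblong₅ r
square≤oblong₅ r = ℕ.≤-trans (square≤oblong₁ r) (ℕ.m≤n⇒m≤1+n (ℕ.*-monoˡ-≤ (tri r) {2} {10} (s≤s (s≤s z≤n))))

oblongs≡1 : ∀ n → oblongs n ≡ 1ℙ → (∃[ j ] oblong₁ j ≡ n) ⊎ (∃[ r ] oblong₅ r ≡ n)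
oblongs≡1 n p with monos oblong₁ n in eq
... | 1ℙ = let j , _ , q = ∑≡1 (suc n) (λ j → mono (oblong₁ j) n) eq in inj₁ (j , mono≡1 (oblong₁ j) n q)
... | 0ℙ = let r , _ , q = ∑≡1 (suc n) (λ r → mono (oblong₅ r) n) p in inj₂ (r , mono≡1 (oblong₅ r) n q)

sumℕ : ℕ → (ℕ → ℕ) → ℕ
sumℕ zero    f = 0
sumℕ (suc s) f = sumℕ s f ℕ.+ f s

sumℕ-mono : ∀ s {f g} → (∀ i → f i ℕ.≤ g i) → sumℕ s f ℕ.≤ sumℕ s g
sumℕ-mono zero    p = z≤n
sumℕ-mono (suc s) p = ℕ.+-mono-≤ (sumℕ-mono s p) (p s)

sumℕ-strict : ∀ s {f g} → (∀ i → f i ℕ.≤ g i) → ∀ j → j ℕ.< s → f j ℕ.< g j → sumℕ s f ℕ.< sumℕ s g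
sumℕ-strict (suc s) p j (s≤s j≤s) q with ℕ.m≤n⇒m<n∨m≡n j≤s
... | inj₁ j<s  = ℕ.+-mono-<-≤ (sumℕ-strict s p j j<s q) (p s)
... | inj₂ refl = ℕ.+-mono-≤-< (sumℕ-mono s p) q

sumℕ-const : ∀ s {f c} → (∀ i → f i ℕ.≤ c) → sumℕ s f ℕ.≤ s ℕ.* c
sumℕ-const zero        p = z≤n
sumℕ-const (suc s) {f} {c} p = ℕ.≤-trans (ℕ.+-mono-≤ (sumℕ-const s p) (p s)) (ℕ.≤-reflexive (ℕ.+-comm (s ℕ.* c) c))

step : ℕ → ℕ → ℕ
step v X = if does (v ℕ.≤? X) then 1 else 0

step≤1 : ∀ v X → step v X ℕ.≤ 1
step≤1 v X with does (v ℕ.≤? X)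
... | true  = ℕ.≤-refl
... | false = z≤n

step-≤ : ∀ {v X} → v ℕ.≤ X → step v X ≡ 1
step-≤ {v} {X} v≤X = cong (λ b → if b then 1 else 0) (dec-true (v ℕ.≤? X) v≤X)

step-> : ∀ {v X} → X ℕ.< v → step v X ≡ 0
step-> {v} {X} X<v = cong (λ b → if b then 1 else 0) (dec-false (v ℕ.≤? X) (ℕ.<⇒≱ X<v))

step-mono : ∀ v X → step v X ℕ.≤ step v (suc X)
step-mono v X with v ℕ.≤? X
... | yes v≤X = ℕ.≤-reflexive (trans (step-≤ v≤X) (sym (step-≤ (ℕ.m≤n⇒m≤1+n v≤X))))
... | no  v≰X = ℕ.≤-trans (ℕ.≤-reflexive (step-> (ℕ.≰⇒> v≰X))) z≤n

step-jump : ∀ X → step (suc X) X ℕ.< step (suc X) (suc X)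
step-jump X = ℕ.≤-reflexive (trans (cong suc (step-> {suc X} ℕ.≤-refl)) (sym (step-≤ {suc X} ℕ.≤-refl)))

-- Exponents up to X are counted through their indices below s, with multiplicity. The bound 2s is
-- then immediate, and overcounting is harmless because only an upper bound on the exceptions is
-- wanted.
hits : ℕ → ℕ → ℕ
hits s X = sumℕ s (λ j → step (oblong₁ j) X) ℕ.+ sumℕ s (λ r → step (oblong₅ r) X)

hits-mono : ∀ s X → hits s X ℕ.≤ hits s (suc X)
hits-mono s X = ℕ.+-mono-≤ (sumℕ-mono s (λ j → step-mono (oblong₁ j) X)) (sumℕ-mono s (λ r → step-mono (oblong₅ r) X))

root< : ∀ {j s X} → j ℕ.* j ℕ.≤ X → X ℕ.< s ℕ.* s → j ℕ.< s
root< {j} {s} j²≤X X<s² with j ℕ.<? s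
... | yes j<s = j<s
... | no  j≮s = ⊥-elim (ℕ.<-irrefl refl (ℕ.<-≤-trans X<s² (ℕ.≤-trans (ℕ.*-mono-≤ (ℕ.≮⇒≥ j≮s) (ℕ.≮⇒≥ j≮s)) j²≤X)))

-- An exponent equal to X + 1 is at least the square of its index, so that index is below s and its
-- `step` switches from 0 to 1 here.
hits-oblong : ∀ s X → suc X ℕ.< s ℕ.* s → oblongs (suc X) ≡ 1ℙ → hits s X ℕ.< hits s (suc X)
hits-oblong s X X<s² p with oblongs≡1 (suc X) p
... | inj₁ (j , eq) = ℕ.+-mono-<-≤
  (sumℕ-strict s (λ j → step-mono (oblong₁ j) X) j (root< (ℕ.≤-trans (square≤oblong₁ j) (ℕ.≤-reflexive eq)) X<s²)
    (subst (λ v → step v X ℕ.< step v (suc X)) (sym eq) (step-jump X)))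
  (sumℕ-mono s (λ r → step-mono (oblong₅ r) X))
... | inj₂ (r , eq) = ℕ.+-mono-≤-<
  (sumℕ-mono s (λ j → step-mono (oblong₁ j) X))
  (sumℕ-strict s (λ r → step-mono (oblong₅ r) X) r (root< (ℕ.≤-trans (square≤oblong₅ r) (ℕ.≤-reflexive eq)) X<s²)
    (subst (λ v → step v X ℕ.< step v (suc X)) (sym eq) (step-jump X)))

hits≤2s : ∀ s X → hits s X ℕ.≤ 2 ℕ.* s
hits≤2s s X = begin
  hits s X            ≤⟨ ℕ.+-mono-≤ (sumℕ-const s (λ j → step≤1 (oblong₁ j) X)) (sumℕ-const s (λ r → step≤1 (oblong₅ r) X)) ⟩
  s ℕ.* 1 ℕ.+ s ℕ.* 1 ≡⟨ identity s ⟩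
  2 ℕ.* s             ∎
  where
  open ℕ.≤-Reasoning
  identity : ∀ s → s ℕ.* 1 ℕ.+ s ℕ.* 1 ≡ 2 ℕ.* s
  identity = solve-ℕ

module _ {P : ℕ → Set} (P? : Decidable P) where

  count : ℕ → ℕ
  count X = length (filter P? (map suc (upTo X)))

  count-suc : ∀ X → count (suc X) ≡ count X ℕ.+ length (filter P? [ suc X ])
  count-suc X = begin
    count (suc X)                                             ≡⟨ cong (λ xs → length (filter P? (map suc xs))) (upTo-∷ʳ X) ⟨
    length (filter P? (map suc (upTo X ++ [ X ])))            ≡⟨ cong (λ xs → length (filter P? xs)) (map-++ suc (upTo X) [ X ]) ⟩
    length (filter P? (map suc (upTo X) ++ [ suc X ]))        ≡⟨ cong length (filter-++ P? (map suc (upTo X)) [ suc X ]) ⟩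
    length (filter P? (map suc (upTo X)) ++ filter P? [ suc X ]) ≡⟨ length-++ (filter P? (map suc (upTo X))) ⟩
    count X ℕ.+ length (filter P? [ suc X ])                  ∎
    where open ≡-Reasoning

  -- Induction on X with s fixed: each new number raises `count` or `hits`. The exponent 0, which
  -- lies outside the range of n, merely weakens the bound.
  count-hits : (∀ n → oblongs n ≡ 0ℙ → P n) → ∀ s X → X ℕ.< s ℕ.* s → X ℕ.≤ count X ℕ.+ hits s X
  count-hits _      s zero    _    = z≤n
  count-hits sparse s (suc X) X<s² = next (oblongs (suc X)) refl
    where
    open ℕ.≤-Reasoning
    next : ∀ p → oblongs (suc X) ≡ p → suc X ℕ.≤ count (suc X) ℕ.+ hits s (suc X)
    next 0ℙ eq = begin
      suc X                               ≤⟨ s≤s (count-hits sparse s X (ℕ.<⇒≤ X<s²)) ⟩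
      suc (count X ℕ.+ hits s X)          ≤⟨ s≤s (ℕ.+-monoʳ-≤ (count X) (hits-mono s X)) ⟩
      suc (count X) ℕ.+ hits s (suc X)    ≡⟨ cong (ℕ._+ hits s (suc X)) (ℕ.+-comm (count X) 1) ⟨
      count X ℕ.+ 1 ℕ.+ hits s (suc X)    ≡⟨ cong (λ xs → count X ℕ.+ length xs ℕ.+ hits s (suc X)) (filter-accept P? (sparse (suc X) eq)) ⟨
      count X ℕ.+ length (filter P? [ suc X ]) ℕ.+ hits s (suc X) ≡⟨ cong (ℕ._+ hits s (suc X)) (count-suc X) ⟨
      count (suc X) ℕ.+ hits s (suc X)    ∎
    next 1ℙ eq = begin
      suc X                               ≤⟨ s≤s (count-hits sparse s X (ℕ.<⇒≤ X<s²)) ⟩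
      suc (count X ℕ.+ hits s X)          ≡⟨ ℕ.+-suc (count X) (hits s X) ⟨
      count X ℕ.+ suc (hits s X)          ≤⟨ ℕ.+-mono-≤ (ℕ.m≤m+n (count X) (length (filter P? [ suc X ]))) (hits-oblong s X X<s² eq) ⟩
      count X ℕ.+ length (filter P? [ suc X ]) ℕ.+ hits s (suc X) ≡⟨ cong (ℕ._+ hits s (suc X)) (count-suc X) ⟨
      count (suc X) ℕ.+ hits s (suc X)    ∎

-- Density

integer-sqrt : ∀ X → ∃[ s ] (s ℕ.* s ℕ.≤ X × X ℕ.< suc s ℕ.* suc s)
integer-sqrt zero    = 0 , z≤n , s≤s z≤n
integer-sqrt (suc X) with integer-sqrt X
... | s , s²≤X , X<[1+s]² with suc s ℕ.* suc s ℕ.≤? suc X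
...   | yes p = suc s , p , ℕ.≤-<-trans X<[1+s]² (ℕ.*-mono-< {suc s} {suc (suc s)} ℕ.≤-refl ℕ.≤-refl)
...   | no ¬p = s , ℕ.m≤n⇒m≤1+n s²≤X , ℕ.≰⇒> ¬p

-- A limit of 1 without real numbers: for each positive k the proportion of exceptions is eventually
-- at most 1/k.
density : ∀ k (f : ℕ → ℕ) → (∀ s X → X ℕ.< s ℕ.* s → X ℕ.≤ f X ℕ.+ hits s X)
        → ∃[ N ] (∀ X → N ℕ.≤ X → k ℕ.* (X ℕ.∸ f X) ℕ.≤ X)
density k f X≤f+hits = N , λ X N≤X → let s , s²≤X , X<[1+s]² = integer-sqrt X in bound X s N≤X s²≤X X<[1+s]²
  where
  -- With s the integer square root of X there are at most 2(s + 1) ≤ 4s exceptions, and k · 4s ≤ s²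
  -- ≤ X once s > 4k, which X ≥ (4k + 1)² ensures.
  N = suc (4 ℕ.* k) ℕ.* suc (4 ℕ.* k)
  bound : ∀ X s → N ℕ.≤ X → s ℕ.* s ℕ.≤ X → X ℕ.< suc s ℕ.* suc s → k ℕ.* (X ℕ.∸ f X) ℕ.≤ X
  bound X s N≤X s²≤X X<[1+s]² = begin
    k ℕ.* (X ℕ.∸ f X)         ≤⟨ ℕ.*-monoʳ-≤ k (ℕ.m≤n+o⇒m∸n≤o X (f X) (X≤f+hits (suc s) X X<[1+s]²)) ⟩
    k ℕ.* hits (suc s) X      ≤⟨ ℕ.*-monoʳ-≤ k (hits≤2s (suc s) X) ⟩
    k ℕ.* (2 ℕ.* suc s)       ≤⟨ ℕ.*-monoʳ-≤ k (ℕ.*-monoʳ-≤ 2 (ℕ.+-monoˡ-≤ s 1≤s)) ⟩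
    k ℕ.* (2 ℕ.* (s ℕ.+ s))   ≡⟨ identity k s ⟩
    4 ℕ.* k ℕ.* s             ≤⟨ ℕ.*-monoˡ-≤ s (ℕ.<⇒≤ 4k<s) ⟩
    s ℕ.* s                   ≤⟨ s²≤X ⟩
    X                         ∎
    where
    open ℕ.≤-Reasoning
    4k<s : 4 ℕ.* k ℕ.< s
    4k<s = ℕ.≤-pred (root< {suc (4 ℕ.* k)} N≤X X<[1+s]²)
    1≤s : 1 ℕ.≤ s
    1≤s = ℕ.≤-trans (s≤s z≤n) 4k<s
    identity : ∀ k s → k ℕ.* (2 ℕ.* (s ℕ.+ s)) ≡ 4 ℕ.* k ℕ.* s
    identity = solve-ℕ

theorem4p1 : (k : ℕ) → NonZero k → ∃[ N ] ((X : ℕ) → N ≤ X → k * (X ∸ evenCount X) ≤ X)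
theorem4p1 k _ = density k evenCount (count-hits (λ n → 2 ∣? ∣ J10 (4 ℕ.* n ℕ.+ 1) ∣)
  (λ n p → parity-even ∣ J10 (4 ℕ.* n ℕ.+ 1) ∣ (trans (J10-parity n) p)))
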